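{- Let $p$ be a prime with $p\equiv -1\pmod 4$. Then for all integers $\alpha\ge0$ and $n\ge0$, \[ \sum_{n=0}^{\infty}b_{16}\!\left(p^{2\alpha}n+\frac{5p^{2\alpha}-5}{8}\right)q^{n} \equiv \psi(q)\psi(q^4) \pmod 2, \] and \[ b_{16}\!\left(p^{2\alpha+2}n+\frac{(8i+5p)p^{2\alpha+1}-5}{8}\right)\equiv 0 \pmod 2,\qquad i=1,2,\ldots,p-1. \]
   Context: For a positive integer $\ell$, $b_\ell(n)$ denotes the number of partitions of $n$ having no part divisible by $\ell$. $\psi(q)=\sum_{n\ge0}q^{n(n+1)/2}$. A congruence between power series modulo $2$ means coefficientwise congruence. -}

module Defs where

open import Data.Bool using (if_then_else_)
open import Data.List using (List; []; _∷_; length; map; filter; upTo; concatMap; cartesianProductWith)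
open import Data.List.Membership.Propositional using (_∈_)
open import Data.List.Membership.Propositional.Properties using (∈-cartesianProductWith⁺; ∈-cartesianProductWith⁻; ∈-upTo⁺; ∈-filter⁺; ∈-filter⁻; ∈-concat⁺′; ∈-map⁺)
open import Data.List.Properties using (∷-injective)
open import Data.List.Relation.Unary.All as All using (All; []; _∷_)
import Data.List.Relation.Unary.All.Properties as All
open import Data.List.Relation.Unary.AllPairs as AllPairs using ([]; _∷_)
import Data.List.Relation.Unary.AllPairs.Properties as AllPairs
open import Data.List.Relation.Unary.Any using (here)
open import Data.List.Relation.Unary.Linked using (Linked; linked?)
open import Data.List.Relation.Unary.Unique.Propositional using (Unique)
import Data.List.Relation.Unary.Unique.Propositional.Properties as Unique
open import Data.Nat using (ℕ; zero; suc; _+_; _*_; _∸_; _≤_; _<_; _≥_; _/_; _%_; _≟_; _<?_; _≥?_; s≤s; NonZero)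
open import Data.Nat.Divisibility using (_∣_; _∤_; _∣?_)
open import Data.Nat.ListAction using (sum)
open import Data.Nat.Properties using (+-mono-≤; ≤-trans; ≤-reflexive; m≤m+n; m≤n+m)
open import Data.Product using (_×_; _,_; proj₂)
open import Function using (_⇔_; mk⇔)
open import Relation.Binary.PropositionalEquality using (_≡_; _≢_; refl; sym; trans; cong)
open import Relation.Nullary using (Dec; ¬?; does; _×-dec_)

IsPartition : ℕ → List ℕ → Set
IsPartition n xs = Linked _≥_ xs × All (0 <_) xs × sum xs ≡ n

IsRegularPartition : ℕ → ℕ → List ℕ → Set
IsRegularPartition ℓ n xs = IsPartition n xs × All (ℓ ∤_) xs

isRegularPartition? : ∀ ℓ n xs → Dec (IsRegularPartition ℓ n xs)
isRegularPartition? ℓ n xs =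
  (linked? _≥?_ xs ×-dec All.all? (0 <?_) xs ×-dec (sum xs ≟ n))
  ×-dec All.all? (λ x → ¬? (ℓ ∣? x)) xs

words : List ℕ → ℕ → List (List ℕ)
words as zero    = [] ∷ []
words as (suc k) = cartesianProductWith _∷_ as (words as k)

-- A partition of n has at most n parts, each at most n, so the search below
-- misses none; ∈-regularPartitions and regularPartitions-unique certify that
-- every ℓ-regular partition of n is listed exactly once.
regularPartitions : ℕ → ℕ → List (List ℕ)
regularPartitions ℓ n =
  filter (isRegularPartition? ℓ n) (concatMap (words (upTo (suc n))) (upTo (suc n)))

b : ℕ → ℕ → ℕ
b ℓ n = length (regularPartitions ℓ n)

∈-words⁺ : ∀ {as} xs → All (_∈ as) xs → xs ∈ words as (length xs)
∈-words⁺ []       []       = here refl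
∈-words⁺ (x ∷ xs) (p ∷ ps) = ∈-cartesianProductWith⁺ _∷_ p (∈-words⁺ xs ps)

∈-words-length : ∀ as k {xs} → xs ∈ words as k → length xs ≡ k
∈-words-length as zero    (here refl) = refl
∈-words-length as (suc k) p with ∈-cartesianProductWith⁻ _∷_ as (words as k) p
... | _ , _ , _ , q , refl = cong suc (∈-words-length as k q)

words-unique : ∀ {as} → Unique as → ∀ k → Unique (words as k)
words-unique u zero    = [] ∷ []
words-unique u (suc k) = Unique.cartesianProductWith⁺ _∷_ ∷-injective u (words-unique u k)

length≤sum : ∀ {xs} → All (0 <_) xs → length xs ≤ sum xs
length≤sum []       = m≤m+n 0 0
length≤sum (p ∷ ps) = +-mono-≤ p (length≤sum ps)

parts≤sum : ∀ xs → All (_≤ sum xs) xs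
parts≤sum []       = []
parts≤sum (x ∷ xs) = m≤m+n x (sum xs) ∷ All.map (λ p → ≤-trans p (m≤n+m (sum xs) x)) (parts≤sum xs)

∈-regularPartitions : ∀ ℓ n xs → xs ∈ regularPartitions ℓ n ⇔ IsRegularPartition ℓ n xs
∈-regularPartitions ℓ n xs = mk⇔ (λ p → proj₂ (∈-filter⁻ (isRegularPartition? ℓ n) {xs = candidates} p)) complete
  where
  candidates = concatMap (words (upTo (suc n))) (upTo (suc n))

  complete : IsRegularPartition ℓ n xs → xs ∈ regularPartitions ℓ n
  complete r@((_ , pos , refl) , _) = ∈-filter⁺ (isRegularPartition? ℓ n)
    (∈-concat⁺′ (∈-words⁺ xs (All.map (λ p → ∈-upTo⁺ (s≤s p)) (parts≤sum xs)))
                (∈-map⁺ (words (upTo (suc n))) (∈-upTo⁺ (s≤s (length≤sum pos)))))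
    r

regularPartitions-unique : ∀ ℓ n → Unique (regularPartitions ℓ n)
regularPartitions-unique ℓ n = Unique.filter⁺ (isRegularPartition? ℓ n)
  (Unique.concat⁺ (All.map⁺ (All.universal (words-unique (Unique.upTo⁺ (suc n))) (upTo (suc n))))
                  (AllPairs.map⁺ (AllPairs.map disjoint (Unique.upTo⁺ (suc n)))))
  where
  disjoint : ∀ {j k} → j ≢ k → ∀ {xs} → xs ∈ words (upTo (suc n)) j × xs ∈ words (upTo (suc n)) k → _
  disjoint j≢k (p , q) = j≢k (trans (sym (∈-words-length _ _ p)) (∈-words-length _ _ q))

-- Every series that occurs has natural-number coefficients; f n is the
-- coefficient of qⁿ.
Series : Set
Series = ℕ → ℕ

infixl 7 _⊛_
_⊛_ : Series → Series → Series
(f ⊛ g) n = sum (map (λ i → f i * g (n ∸ i)) (upTo (suc n)))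

-- The series f(qᵏ).
_⟨q^_⟩ : Series → (k : ℕ) .{{_ : NonZero k}} → Series
(f ⟨q^ k ⟩) n = if does (k ∣? n) then f (n / k) else 0

-- The coefficient of qᵐ is the number of k with k(k+1)/2 = m; since
-- k ≤ k(k+1)/2, only k ≤ m need be examined.
ψ : Series
ψ m = length (filter (λ k → k * (k + 1) / 2 ≟ m) (upTo (suc m)))

infix 4 _≡_[mod_] _≋_[mod_]
_≡_[mod_] : ℕ → ℕ → (k : ℕ) .{{_ : NonZero k}} → Set
m ≡ n [mod k ] = m % k ≡ n % k

_≋_[mod_] : Series → Series → (k : ℕ) .{{_ : NonZero k}} → Set
f ≋ g [mod k ] = ∀ n → f n ≡ g n [mod k ]

module Submission where

-- Modulo 2 let P = ∏ (1 + qᵏ).  The generating function of b₁₆ is P¹⁶ / P, and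
-- Gauss's product for ψ becomes ψ = P⁴ / P, so Σ b₁₆(n) qⁿ = P¹⁵ = ψ ψ⁴ = ψ(q) ψ(q⁴).
-- Hence b₁₆(n) has the parity of the number of representations 8n + 5 = x² + (2y)²
-- with x, y odd and positive.  For a prime p ≡ 3 (mod 4), p ∣ x² + (2y)² forces p ∣ x
-- and p ∣ y: multiplying 8n + 5 by p² only scales the representations, and there are
-- none when p divides 8n + 5 exactly once.

open import Defs
open import Algebra.Bundles using (CommutativeSemiring; RawRing)
import Algebra.Properties.CommutativeSemigroup as CommutativeSemigroupProperties
import Algebra.Properties.CommutativeSemiring.Binomial as Binomial
import Algebra.Properties.CommutativeSemiring.Exp as CommutativeExp
import Algebra.Properties.Semiring.Exp as Exp
import Algebra.Properties.Semiring.Mult as Mult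
import Algebra.Properties.Semiring.Sum as Sum
import Algebra.Solver.Ring as RingSolver
open import Algebra.Solver.Ring.AlmostCommutativeRing
  using (fromCommutativeSemiring; _-Raw-AlmostCommutative⟶_)
open import Algebra.Structures.Biased using (IsCommutativeMonoidˡ; IsCommutativeSemiringˡ)
open import Data.Bool using (if_then_else_)
open import Data.Empty using (⊥; ⊥-elim)
open import Data.Fin using (toℕ; inject₁) renaming (zero to fzero; suc to fsuc)
import Data.Fin.Properties as Fin
open import Data.List
  using (List; []; _∷_; _++_; _∷ʳ_; length; map; filter; upTo; applyUpTo)
open import Data.List.Membership.Propositional using (_∈_)
open import Data.List.Membership.Propositional.Properties
  using (∈-filter⁺; ∈-filter⁻; ∈-map⁺; ∈-map⁻; ∈-++⁺ˡ; ∈-++⁺ʳ; ∈-++⁻; ∈-upTo⁺; ∈-upTo⁻)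
open import Data.List.Membership.Propositional.Properties.WithK using (unique∧set⇒bag)
open import Data.List.Properties
  using (map-applyUpTo; map-upTo; upTo-∷ʳ; filter-++; filter-accept; filter-reject;
         length-++; length-map; map-∘; map-cong-local; ∷-injectiveʳ)
open import Data.List.Relation.Binary.BagAndSetEquality using (∼bag⇒↭)
open import Data.List.Relation.Binary.Permutation.Propositional using (_↭_)
open import Data.List.Relation.Binary.Permutation.Propositional.Properties
  using (↭-length) renaming (map⁺ to ↭-map⁺)
open import Data.List.Relation.Unary.All as All using (All; []; _∷_)
open import Data.List.Relation.Unary.All.Properties using (all-upTo)
import Data.List.Relation.Unary.AllPairs as AllPairs
open import Data.List.Relation.Unary.Any using (here)
open import Data.List.Relation.Unary.Linked as Linked using (Linked; linked?; [-]; _∷_)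
open import Data.List.Relation.Unary.Unique.Propositional using (Unique)
import Data.List.Relation.Unary.Unique.Propositional.Properties as Unique
open import Data.Maybe using (Maybe; just; nothing)
import Data.Nat as ℕ
open import Data.Nat
  using (ℕ; zero; suc; _≤_; _<_; _≥_; _≥?_; z≤n; s≤s; _∸_; _/_; _%_; _≟_; parity)
open import Data.Nat.Combinatorics using (_C_; nCn≡1; nC1≡n; nCk+nC[k+1]≡[n+1]C[k+1])
open import Data.Nat.Divisibility
import Data.Nat.DivMod as ℕ
open import Data.Nat.ListAction using (sum)
open import Data.Nat.ListAction.Properties using (sum-↭)
open import Data.Nat.Primality using (Prime; euclidsLemma; prime⇒nonZero; ¬prime[1])
import Data.Nat.Properties as ℕ
import Data.Nat.Tactic.RingSolver as ℕSolver
open import Data.Parity using (Parity; 0ℙ; 1ℙ)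
  renaming (_+_ to infixl 6 _⊕_; _*_ to infixl 7 _⊗_)
import Data.Parity.Properties as ℙ
import Data.Product as Product
open import Data.Product using (_×_; _,_; proj₁; proj₂; ∃₂; ∃-syntax)
open import Data.Sum using (_⊎_; inj₁; inj₂; [_,_]′)
open import Data.Vec.Functional using (Vector; init; last; tail)
open import Function using (_∘_; id; _⇔_; mk⇔; Equivalence)
open import Level using (Level; 0ℓ)
open import Relation.Binary.PropositionalEquality
  using (_≡_; _≢_; refl; sym; trans; cong; cong₂; subst; subst₂; module ≡-Reasoning)
import Relation.Binary.Reasoning.Setoid as SetoidReasoning
open import Relation.Binary.Structures using (IsEquivalence)
open import Relation.Nullary using (Dec; yes; no; does; ¬?; toSum)

-- Gauss's identity for ψ in characteristic two

-- No infinite product and no inverse is formed. Each identity is proved modulo X^(N+1) for the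
-- finite product `eulerProduct N`, and quotients such as P⁴ / P are avoided by cancelling a power
-- of P, whose constant term is 1. Gauss's identity therefore enters in a finite form due to Shanks,
-- whose error term starts in degree 2N + 1. It holds over any commutative semiring with 1 + 1 = 0,
-- where the signs of the classical proof disappear. In the arithmetic half the prime is written p =
-- 2h + 1, so that (p² - 1)/8 is the triangular number `T h`; the shifts of index are built from
-- this constant.

CharacteristicTwo : ∀ {c ℓ : Level} → CommutativeSemiring c ℓ → Set ℓ
CharacteristicTwo R = 1# + 1# ≈ 0#
  where open CommutativeSemiring R

-- With `Parity` as coefficient ring the solver normalises modulo 2, so it cancels equal terms by
-- itself; negation is the identity.
module CharTwo {c ℓ : Level} (R : CommutativeSemiring c ℓ) (1+1≈0 : CharacteristicTwo R) where

  open CommutativeSemiring R renaming (refl to ≈-refl; sym to ≈-sym; trans to ≈-trans)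

  private
    ℙ-rawRing : RawRing 0ℓ 0ℓ
    ℙ-rawRing = record
      { Carrier = Parity ; _≈_ = _≡_ ; _+_ = _⊕_ ; _*_ = _⊗_ ; -_ = id ; 0# = 0ℙ ; 1# = 1ℙ }

    ⟦_⟧ᶜ : Parity → Carrier
    ⟦ 0ℙ ⟧ᶜ = 0#
    ⟦ 1ℙ ⟧ᶜ = 1#

    ⟦⟧-+ : ∀ p q → ⟦ p ⊕ q ⟧ᶜ ≈ ⟦ p ⟧ᶜ + ⟦ q ⟧ᶜ
    ⟦⟧-+ 0ℙ q  = ≈-sym (+-identityˡ _)
    ⟦⟧-+ 1ℙ 0ℙ = ≈-sym (+-identityʳ _)
    ⟦⟧-+ 1ℙ 1ℙ = ≈-sym 1+1≈0

    ⟦⟧-* : ∀ p q → ⟦ p ⊗ q ⟧ᶜ ≈ ⟦ p ⟧ᶜ * ⟦ q ⟧ᶜ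
    ⟦⟧-* 0ℙ q = ≈-sym (zeroˡ _)
    ⟦⟧-* 1ℙ q = ≈-sym (*-identityˡ _)

    morphism : ℙ-rawRing -Raw-AlmostCommutative⟶ fromCommutativeSemiring R
    morphism = record
      { ⟦_⟧ = ⟦_⟧ᶜ ; +-homo = ⟦⟧-+ ; *-homo = ⟦⟧-*
      ; -‿homo = λ _ → ≈-refl
      ; 0-homo = ≈-refl
      ; 1-homo = ≈-refl }

    _≟ᶜ_ : ∀ p q → Maybe (⟦ p ⟧ᶜ ≈ ⟦ q ⟧ᶜ)
    0ℙ ≟ᶜ 0ℙ = just ≈-refl
    1ℙ ≟ᶜ 1ℙ = just ≈-refl
    _  ≟ᶜ _  = nothing

  open RingSolver ℙ-rawRing (fromCommutativeSemiring R) morphism _≟ᶜ_ public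
    using (solve; _:=_; _:+_; _:*_; _:^_; con)

module Shanks {c ℓ : Level} (R : CommutativeSemiring c ℓ)
  (1+1≈0 : CharacteristicTwo R) (q : CommutativeSemiring.Carrier R) where

  open CommutativeSemiring R renaming (refl to ≈-refl; sym to ≈-sym; trans to ≈-trans)

  open Exp semiring using (_^_; ^-congˡ)
  open CommutativeExp R using (^-distrib-*)
  open CharTwo R 1+1≈0
  open SetoidReasoning setoid

  -- Up to signs, Gauss's product is ψ = ∏ (1 - q^(2k)) / ∏ (1 - q^(2k-1)). `oddFactors` truncates
  -- its denominator and `evenFactors` its numerator.
  oddFactors : ℕ → Carrier
  oddFactors zero    = 1#
  oddFactors (suc n) = oddFactors n * (1# + q * (q * q) ^ n)

  evenFactors : ℕ → Carrier
  evenFactors zero    = 1#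
  evenFactors (suc n) = evenFactors n * (1# + (q * q) ^ suc n)

  -- The summands are q^T(2n+1) and q^T(2n+2), where T k = k(k+1)/2.
  triangularSum : ℕ → Carrier
  triangularSum zero    = 1#
  triangularSum (suc n) =
    triangularSum n + ((q * (q * q) ^ n) ^ suc n + (q * (q * q) ^ suc n) ^ suc n)

  -- ∑_{s ≤ n} (∏_{k ≤ s} (1 + q^(2k-1))) (∏_{s < k ≤ n} (1 + q^(2k))) xˢ.  At x = q^(2n+1) this
  -- is, with cleared denominators, the finite sum in Shanks's proof of Gauss's identity.
  transform : Carrier → ℕ → Carrier
  transform x zero    = 1#
  transform x (suc n) = (1# + (q * q) ^ suc n) * transform x n + oddFactors (suc n) * x ^ suc n

  transform-cong : ∀ {x y} n → x ≈ y → transform x n ≈ transform y n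
  transform-cong zero    x≈y = ≈-refl
  transform-cong (suc n) x≈y = +-cong (*-congˡ (transform-cong n x≈y)) (*-congˡ (^-congˡ (suc n) x≈y))

  -- A q-difference equation. Passing from n to n + 1 multiplies the old right side by 1 + q^(2n+2)
  -- and adds one summand to `transform`; its contribution in x^(n+1) equals that old term and
  -- cancels it in characteristic two, which leaves only x^(n+2).
  transform-telescope : ∀ x n →
    (1# + x) * transform x n + (1# + q * x) * transform (q * q * x) n ≈ oddFactors (suc n) * x ^ suc n
  transform-telescope x zero = solve 2 (λ q x → let 1' = con 1ℙ in
    (1' :+ x) :* 1' :+ (1' :+ q :* x) :* 1' := 1' :* (1' :+ q :* 1') :* (x :* 1')) ≈-refl q x
  transform-telescope x (suc n) = begin
    (1# + x) * ((1# + W) * a + d * x ^ suc n) + (1# + q * x) * ((1# + W) * a′ + d * (q * q * x) ^ suc n)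
      ≈⟨ +-congˡ (*-congˡ (+-congˡ (*-congˡ (^-distrib-* (q * q) x (suc n))))) ⟩
    (1# + x) * ((1# + W) * a + d * x ^ suc n) + (1# + q * x) * ((1# + W) * a′ + d * (W * x ^ suc n))
      ≈⟨ solve 7 (λ q x W a a′ d y → let 1' = con 1ℙ in
           (1' :+ x) :* ((1' :+ W) :* a :+ d :* y) :+ (1' :+ q :* x) :* ((1' :+ W) :* a′ :+ d :* (W :* y))
           := (1' :+ W) :* ((1' :+ x) :* a :+ (1' :+ q :* x) :* a′)
              :+ ((1' :+ x) :* (d :* y) :+ (1' :+ q :* x) :* (d :* (W :* y))))
         ≈-refl q x W a a′ d (x ^ suc n) ⟩
    (1# + W) * ((1# + x) * a + (1# + q * x) * a′)
      + ((1# + x) * (d * x ^ suc n) + (1# + q * x) * (d * (W * x ^ suc n)))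
      ≈⟨ +-congʳ (*-congˡ (transform-telescope x n)) ⟩
    (1# + W) * (d * x ^ suc n)
      + ((1# + x) * (d * x ^ suc n) + (1# + q * x) * (d * (W * x ^ suc n)))
      ≈⟨ solve 5 (λ q x W d y → let 1' = con 1ℙ in
           (1' :+ W) :* (d :* y) :+ ((1' :+ x) :* (d :* y) :+ (1' :+ q :* x) :* (d :* (W :* y)))
           := d :* (1' :+ q :* W) :* (x :* y))
         ≈-refl q x W d (x ^ suc n) ⟩
    oddFactors (suc (suc n)) * x ^ suc (suc n) ∎
    where
    W = (q * q) ^ suc n
    a = transform x n
    a′ = transform (q * q * x) n
    d = oddFactors (suc n)

  -- At x = q^(2n+1) the new even factor 1 + q^(2n+2) is 1 + q x, so the telescoping identity trades
  -- the transform at q² x for the one at x. The two powers left over are the next two triangular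
  -- powers.
  transform-odd-power : ∀ n → transform (q * (q * q) ^ n) n ≈ oddFactors n * triangularSum n
  transform-odd-power zero    = ≈-sym (*-identityˡ 1#)
  transform-odd-power (suc n) = begin
    (1# + q * q * w) * transform (q * (q * q * w)) n + d * (1# + x) * y′
      ≈⟨ +-congʳ (*-congˡ (transform-cong n
           (solve 2 (λ q w → q :* (q :* q :* w) := q :* q :* (q :* w)) ≈-refl q w))) ⟩
    (1# + q * q * w) * a′ + d * (1# + x) * y′
      -- The term (1 + x) a is inserted twice, that is, zero is added: one copy meets the induction
      -- hypothesis, the other completes the telescoping sum.
      ≈⟨ solve 6 (λ q w a a′ d y′ → let 1' = con 1ℙ; x = q :* w in
           (1' :+ q :* q :* w) :* a′ :+ d :* (1' :+ x) :* y′
           := (1' :+ x) :* a :+ ((1' :+ x) :* a :+ (1' :+ q :* x) :* a′) :+ d :* (1' :+ x) :* y′)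
         ≈-refl q w a a′ d y′ ⟩
    (1# + x) * a + ((1# + x) * a + (1# + q * x) * a′) + d * (1# + x) * y′
      ≈⟨ +-congʳ (+-cong (*-congˡ (transform-odd-power n)) (transform-telescope x n)) ⟩
    (1# + x) * (d * triangularSum n) + d * (1# + x) * y + d * (1# + x) * y′
      ≈⟨ solve 5 (λ x d s y y′ → let 1' = con 1ℙ in
           (1' :+ x) :* (d :* s) :+ d :* (1' :+ x) :* y :+ d :* (1' :+ x) :* y′
           := d :* (1' :+ x) :* (s :+ (y :+ y′)))
         ≈-refl x d (triangularSum n) y y′ ⟩
    d * (1# + x) * (triangularSum n + (y + y′)) ∎
    where
    w = (q * q) ^ n
    x = q * w
    a = transform x n
    a′ = transform (q * q * x) n
    d = oddFactors n
    y = x ^ suc n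
    y′ = (q * (q * q) ^ suc n) ^ suc n

  -- Only the summand s = 0 is free of x, and it is the full product of even factors.
  transform-remainder : ∀ x n → ∃[ r ] transform x n ≈ evenFactors n + x * r
  transform-remainder x zero    = 0# , solve 1 (λ x → con 1ℙ := con 1ℙ :+ x :* con 0ℙ) ≈-refl x
  transform-remainder x (suc n) with r , eq ← transform-remainder x n = W * r + d * x ^ n , (begin
    W * transform x n + d * (x * x ^ n)
      ≈⟨ +-congʳ (*-congˡ eq) ⟩
    W * (evenFactors n + x * r) + d * (x * x ^ n)
      ≈⟨ solve 6 (λ W e x r d y → W :* (e :+ x :* r) :+ d :* (x :* y) := e :* W :+ x :* (W :* r :+ d :* y))
         ≈-refl W (evenFactors n) x r d (x ^ n) ⟩
    evenFactors n * W + x * (W * r + d * x ^ n) ∎)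
    where
    W = 1# + (q * q) ^ suc n
    d = oddFactors (suc n)

  -- Two evaluations of the transform at x = q^(2n+1) are compared. For q = X the remainder is
  -- invisible below degree 2n + 1, so this is Gauss's identity to that precision.
  triangularSum-product : ∀ n →
    ∃[ r ] oddFactors n * triangularSum n ≈ evenFactors n + q * (q * q) ^ n * r
  triangularSum-product n with r , eq ← transform-remainder (q * (q * q) ^ n) n =
    r , ≈-trans (≈-sym (transform-odd-power n)) eq

-- Triangular numbers

T : ℕ → ℕ
T k = k ℕ.* (k ℕ.+ 1) ℕ./ 2

T≡ : ∀ k {m} → k ℕ.* (k ℕ.+ 1) ≡ m ℕ.* 2 → T k ≡ m
T≡ k {m} eq = trans (cong (ℕ._/ 2) eq) (ℕ.m*n/n≡m m 2)

T-double : ∀ k → T (k ℕ.+ k) ≡ k ℕ.* (k ℕ.+ k ℕ.+ 1)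
T-double k = T≡ (k ℕ.+ k) (identity k)
  where
  identity : ∀ k → (k ℕ.+ k) ℕ.* (k ℕ.+ k ℕ.+ 1) ≡ k ℕ.* (k ℕ.+ k ℕ.+ 1) ℕ.* 2
  identity = ℕSolver.solve-∀

T-suc-double : ∀ k → T (suc (k ℕ.+ k)) ≡ suc (k ℕ.+ k) ℕ.* suc k
T-suc-double k = T≡ (suc (k ℕ.+ k)) (identity k)
  where
  identity : ∀ k → suc (k ℕ.+ k) ℕ.* (suc (k ℕ.+ k) ℕ.+ 1) ≡ suc (k ℕ.+ k) ℕ.* suc k ℕ.* 2
  identity = ℕSolver.solve-∀

data Halves : ℕ → Set where
  even : ∀ k → Halves (k ℕ.+ k)
  odd  : ∀ k → Halves (suc (k ℕ.+ k))

halves : ∀ n → Halves n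
halves zero = even 0
halves (suc n) with halves n
... | even k = odd k
... | odd k  = subst Halves (cong suc (ℕ.+-suc k k)) (even (suc k))

-- Completing the square turns questions about triangular numbers into questions about odd squares.
-- The split by parity of k makes the halving in `T` exact.
8*T+1≡[2k+1]² : ∀ k → 8 ℕ.* T k ℕ.+ 1 ≡ (k ℕ.+ k ℕ.+ 1) ℕ.* (k ℕ.+ k ℕ.+ 1)
8*T+1≡[2k+1]² k with halves k
... | even j = trans (cong (λ t → 8 ℕ.* t ℕ.+ 1) (T-double j)) (identity j)
  where
  identity : ∀ j → 8 ℕ.* (j ℕ.* (j ℕ.+ j ℕ.+ 1)) ℕ.+ 1
    ≡ (j ℕ.+ j ℕ.+ (j ℕ.+ j) ℕ.+ 1) ℕ.* (j ℕ.+ j ℕ.+ (j ℕ.+ j) ℕ.+ 1)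
  identity = ℕSolver.solve-∀
... | odd j  = trans (cong (λ t → 8 ℕ.* t ℕ.+ 1) (T-suc-double j)) (identity j)
  where
  identity : ∀ j → 8 ℕ.* (suc (j ℕ.+ j) ℕ.* suc j) ℕ.+ 1
    ≡ (suc (j ℕ.+ j) ℕ.+ suc (j ℕ.+ j) ℕ.+ 1) ℕ.* (suc (j ℕ.+ j) ℕ.+ suc (j ℕ.+ j) ℕ.+ 1)
  identity = ℕSolver.solve-∀

k≤T : ∀ k → k ≤ T k
k≤T zero    = z≤n
k≤T (suc k) = subst (_≤ T (suc k)) (ℕ.m*n/n≡m (suc k) 2)
  (ℕ./-monoˡ-≤ 2 (ℕ.*-monoʳ-≤ (suc k) (s≤s (ℕ.m≤n+m 1 k))))

-- Regular partitions with bounded parts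

-- The counting principle used throughout: two duplicate-free lists are compared by membership in
-- both directions.
unique∧set⇒↭ : ∀ {A : Set} {xs ys : List A} → Unique xs → Unique ys →
  (∀ {x} → x ∈ xs ⇔ x ∈ ys) → xs ↭ ys
unique∧set⇒↭ u v eq = ∼bag⇒↭ (unique∧set⇒bag u v eq)

-- Prefixing m to a weakly decreasing list bounds its largest part by m, and covers the empty
-- partition without a separate case.
boundedPartitions : ℕ → ℕ → ℕ → List (List ℕ)
boundedPartitions ℓ m n = filter (λ xs → linked? _≥?_ (m ∷ xs)) (regularPartitions ℓ n)

bounded : ℕ → ℕ → ℕ → ℕ
bounded ℓ m n = length (boundedPartitions ℓ m n)

boundedPartitions-unique : ∀ ℓ m n → Unique (boundedPartitions ℓ m n)
boundedPartitions-unique ℓ m n = Unique.filter⁺ _ (regularPartitions-unique ℓ n)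

∈-boundedPartitions⁺ : ∀ ℓ {m n xs} → Linked _≥_ (m ∷ xs) → IsRegularPartition ℓ n xs →
  xs ∈ boundedPartitions ℓ m n
∈-boundedPartitions⁺ ℓ {m} {n} {xs} l r =
  ∈-filter⁺ (λ ys → linked? _≥?_ (m ∷ ys)) (Equivalence.from (∈-regularPartitions ℓ n xs) r) l

∈-boundedPartitions⁻ : ∀ ℓ m n {xs} → xs ∈ boundedPartitions ℓ m n →
  Linked _≥_ (m ∷ xs) × IsRegularPartition ℓ n xs
∈-boundedPartitions⁻ ℓ m n {xs} p with ∈-filter⁻ (λ ys → linked? _≥?_ (m ∷ ys)) {xs = regularPartitions ℓ n} p
... | q , l = l , Equivalence.to (∈-regularPartitions ℓ n xs) q

weaken-bound : ∀ {m xs} → Linked _≥_ (m ∷ xs) → Linked _≥_ (suc m ∷ xs)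
weaken-bound [-]     = [-]
weaken-bound (p ∷ l) = ℕ.m≤n⇒m≤1+n p ∷ l

-- Either alternative forbids m + 1 as a part: it is a multiple of ℓ, or it exceeds the number
-- partitioned.
bounded-skip : ∀ ℓ m n → ℓ ∣ suc m ⊎ n < suc m → bounded ℓ (suc m) n ≡ bounded ℓ m n
bounded-skip ℓ m n skip = ↭-length (unique∧set⇒↭
  (boundedPartitions-unique ℓ (suc m) n) (boundedPartitions-unique ℓ m n)
  (mk⇔ to from))
  where
  tighten : ∀ {xs} → Linked _≥_ (suc m ∷ xs) → IsRegularPartition ℓ n xs → Linked _≥_ (m ∷ xs)
  tighten [-]                   _ = [-]
  tighten {x ∷ xs} (p ∷ l) ((_ , _ , eq) , ℓ∤x ∷ _) = ℕ.s≤s⁻¹ (ℕ.≤∧≢⇒< p x≢1+m) ∷ l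
    where
    x≢1+m : x ≢ suc m
    x≢1+m refl = [ ℓ∤x , (λ n<1+m → ℕ.<⇒≱ n<1+m (subst (suc m ≤_) eq (ℕ.m≤m+n (suc m) (sum xs)))) ]′ skip

  to : ∀ {xs} → xs ∈ boundedPartitions ℓ (suc m) n → xs ∈ boundedPartitions ℓ m n
  to p with l , r ← ∈-boundedPartitions⁻ ℓ (suc m) n p = ∈-boundedPartitions⁺ ℓ (tighten l r) r

  from : ∀ {xs} → xs ∈ boundedPartitions ℓ m n → xs ∈ boundedPartitions ℓ (suc m) n
  from p with l , r ← ∈-boundedPartitions⁻ ℓ m n p = ∈-boundedPartitions⁺ ℓ (weaken-bound l) r

-- Split by whether m + 1 occurs. If it does, deleting one copy leaves a partition of n still
-- bounded by m + 1, since parts may repeat.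
bounded-use : ∀ ℓ m n → ℓ ∤ suc m →
  bounded ℓ (suc m) (suc m ℕ.+ n) ≡ bounded ℓ m (suc m ℕ.+ n) ℕ.+ bounded ℓ (suc m) n
bounded-use ℓ m n ℓ∤1+m = begin
  bounded ℓ (suc m) (suc m ℕ.+ n)
    ≡⟨ ↭-length (unique∧set⇒↭ (boundedPartitions-unique ℓ (suc m) (suc m ℕ.+ n)) unique (mk⇔ to from)) ⟩
  length (without ++ with-largest)
    ≡⟨ length-++ without ⟩
  length without ℕ.+ length with-largest
    ≡⟨ cong (length without ℕ.+_) (length-map (suc m ∷_) (boundedPartitions ℓ (suc m) n)) ⟩
  bounded ℓ m (suc m ℕ.+ n) ℕ.+ bounded ℓ (suc m) n ∎
  where
  open ≡-Reasoning
  without = boundedPartitions ℓ m (suc m ℕ.+ n)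
  with-largest = map (suc m ∷_) (boundedPartitions ℓ (suc m) n)

  disjoint : ∀ {xs} → xs ∈ without × xs ∈ with-largest → ⊥
  disjoint (p , q) with _ , _ , refl ← ∈-map⁻ (suc m ∷_) q =
    ℕ.<-irrefl refl (Linked.head (proj₁ (∈-boundedPartitions⁻ ℓ m (suc m ℕ.+ n) p)))

  unique : Unique (without ++ with-largest)
  unique = Unique.++⁺ (boundedPartitions-unique ℓ m (suc m ℕ.+ n))
    (Unique.map⁺ ∷-injectiveʳ (boundedPartitions-unique ℓ (suc m) n)) disjoint

  to : ∀ {xs} → xs ∈ boundedPartitions ℓ (suc m) (suc m ℕ.+ n) → xs ∈ without ++ with-largest
  to p with ∈-boundedPartitions⁻ ℓ (suc m) (suc m ℕ.+ n) p
  ... | [-] , r = ∈-++⁺ˡ (∈-boundedPartitions⁺ ℓ [-] r)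
  to {x ∷ xs} p | (x≤1+m ∷ l) , r@((_ , _ ∷ pos , eq) , _ ∷ reg) with x ≟ suc m
  ... | no x≢1+m = ∈-++⁺ˡ (∈-boundedPartitions⁺ ℓ (ℕ.s≤s⁻¹ (ℕ.≤∧≢⇒< x≤1+m x≢1+m) ∷ l) r)
  ... | yes refl = ∈-++⁺ʳ without (∈-map⁺ (suc m ∷_)
        (∈-boundedPartitions⁺ ℓ l ((Linked.tail l , pos , ℕ.+-cancelˡ-≡ (suc m) _ _ eq) , reg)))

  from : ∀ {xs} → xs ∈ without ++ with-largest → xs ∈ boundedPartitions ℓ (suc m) (suc m ℕ.+ n)
  from p with ∈-++⁻ without p
  ... | inj₁ q with l , r ← ∈-boundedPartitions⁻ ℓ m (suc m ℕ.+ n) q = ∈-boundedPartitions⁺ ℓ (weaken-bound l) r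
  ... | inj₂ q with ys , q′ , refl ← ∈-map⁻ (suc m ∷_) q
      with l , ((_ , pos , eq) , reg) ← ∈-boundedPartitions⁻ ℓ (suc m) n q′ =
    ∈-boundedPartitions⁺ ℓ (ℕ.≤-refl ∷ l) ((l , s≤s z≤n ∷ pos , cong (suc m ℕ.+_) eq) , ℓ∤1+m ∷ reg)

bounded-zero : ∀ ℓ n → bounded ℓ 0 (suc n) ≡ 0
bounded-zero ℓ n = ↭-length (unique∧set⇒↭ (boundedPartitions-unique ℓ 0 (suc n)) AllPairs.[]
  (mk⇔ (λ p → ⊥-elim (empty p)) λ ()))
  where
  empty : ∀ {xs} → xs ∈ boundedPartitions ℓ 0 (suc n) → ⊥
  empty p with ∈-boundedPartitions⁻ ℓ 0 (suc n) p
  ... | [-] , (_ , _ , ()) , _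
  ... | x≤0 ∷ _ , (_ , 0<x ∷ _ , _) , _ = ℕ.<⇒≱ 0<x x≤0

bounded≡b : ∀ ℓ {m n} → n ≤ m → bounded ℓ m n ≡ b ℓ n
bounded≡b ℓ {m} {n} n≤m = ↭-length (unique∧set⇒↭ (boundedPartitions-unique ℓ m n) (regularPartitions-unique ℓ n)
  (mk⇔ (λ p → Equivalence.from (∈-regularPartitions ℓ n _) (proj₂ (∈-boundedPartitions⁻ ℓ m n p)))
       (λ p → let r = Equivalence.to (∈-regularPartitions ℓ n _) p in ∈-boundedPartitions⁺ ℓ (bound r) r)))
  where
  bound : ∀ {xs} → IsRegularPartition ℓ n xs → Linked _≥_ (m ∷ xs)
  bound {[]}     _ = [-]
  bound {x ∷ xs} ((l , _ , eq) , _) = ℕ.≤-trans (subst (x ≤_) eq (ℕ.m≤m+n x (sum xs))) n≤m ∷ l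

-- Coefficients of f(qᵏ)

⟨q^⟩-multiple : ∀ f k .{{_ : ℕ.NonZero k}} n → (f ⟨q^ k ⟩) (n ℕ.* k) ≡ f n
⟨q^⟩-multiple f k n with k ∣? n ℕ.* k
... | yes _   = cong f (ℕ.m*n/n≡m n k)
... | no  k∤n = ⊥-elim (k∤n (n∣m*n n))

⟨q^⟩-nonmultiple : ∀ f k .{{_ : ℕ.NonZero k}} {n} → k ∤ n → (f ⟨q^ k ⟩) n ≡ 0
⟨q^⟩-nonmultiple f k {n} k∤n with k ∣? n
... | yes k∣n = ⊥-elim (k∤n k∣n)
... | no  _   = refl

-- Power series over ℤ/2

module PowerSeries where

  ℙ⟦X⟧ : Set
  ℙ⟦X⟧ = ℕ → Parity

  infix 4 _≈_ _≈[_]_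
  _≈_ : ℙ⟦X⟧ → ℙ⟦X⟧ → Set
  f ≈ g = ∀ n → f n ≡ g n

  -- Congruence modulo X^(N+1), which takes the place of convergence of infinite products.
  _≈[_]_ : ℙ⟦X⟧ → ℕ → ℙ⟦X⟧ → Set
  f ≈[ N ] g = ∀ {n} → n ≤ N → f n ≡ g n

  private
    0ₛ 1ₛ : ℙ⟦X⟧
    0ₛ _ = 0ℙ
    1ₛ zero    = 1ℙ
    1ₛ (suc _) = 0ℙ

    infixl 6 _+ₛ_
    infixl 7 _*ₛ_ _·ₛ_
    -- The product is the Cauchy product, computed by splitting the first factor as its constant
    -- term plus X times its tail. The ring laws then follow by structural induction on the degree.
    _+ₛ_ _*ₛ_ : ℙ⟦X⟧ → ℙ⟦X⟧ → ℙ⟦X⟧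
    (f +ₛ g) n = f n ⊕ g n
    (f *ₛ g) zero    = f 0 ⊗ g 0
    (f *ₛ g) (suc n) = f 0 ⊗ g (suc n) ⊕ ((f ∘ suc) *ₛ g) n

    _·ₛ_ : Parity → ℙ⟦X⟧ → ℙ⟦X⟧
    (a ·ₛ f) n = a ⊗ f n

    *ₛ-cong-≤ : ∀ {f f′ g g′} N → f ≈[ N ] f′ → g ≈[ N ] g′ → f *ₛ g ≈[ N ] f′ *ₛ g′
    *ₛ-cong-≤ N p q {zero}  _         = cong₂ _⊗_ (p z≤n) (q z≤n)
    *ₛ-cong-≤ (suc N) p q {suc n} (s≤s l) = cong₂ _⊕_ (cong₂ _⊗_ (p z≤n) (q (s≤s l)))
      (*ₛ-cong-≤ N (p ∘ s≤s) (q ∘ ℕ.m≤n⇒m≤1+n) l)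

    ℙ-interchange : ∀ a b c d → (a ⊕ b) ⊕ (c ⊕ d) ≡ (a ⊕ c) ⊕ (b ⊕ d)
    ℙ-interchange = interchange
      where open CommutativeSemigroupProperties ℙ.+-commutativeSemigroup

    *ₛ-zeroˡ : ∀ g → 0ₛ *ₛ g ≈ 0ₛ
    *ₛ-zeroˡ g zero    = refl
    *ₛ-zeroˡ g (suc n) = *ₛ-zeroˡ g n

    *ₛ-identityˡ : ∀ g → 1ₛ *ₛ g ≈ g
    *ₛ-identityˡ g zero    = refl
    *ₛ-identityˡ g (suc n) = trans (cong (g (suc n) ⊕_) (*ₛ-zeroˡ g n)) (ℙ.+-identityʳ _)

    *ₛ-distribʳ : ∀ h f g → (f +ₛ g) *ₛ h ≈ f *ₛ h +ₛ g *ₛ h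
    *ₛ-distribʳ h f g zero    = ℙ.*-distribʳ-+ (h 0) (f 0) (g 0)
    *ₛ-distribʳ h f g (suc n) = trans
      (cong₂ _⊕_ (ℙ.*-distribʳ-+ (h (suc n)) (f 0) (g 0)) (*ₛ-distribʳ h (f ∘ suc) (g ∘ suc) n))
      (ℙ-interchange (f 0 ⊗ h (suc n)) _ _ _)

    ·ₛ-*ₛ-assoc : ∀ a f g → (a ·ₛ f) *ₛ g ≈ a ·ₛ (f *ₛ g)
    ·ₛ-*ₛ-assoc a f g zero    = ℙ.*-assoc a _ _
    ·ₛ-*ₛ-assoc a f g (suc n) = trans
      (cong₂ _⊕_ (ℙ.*-assoc a _ _) (·ₛ-*ₛ-assoc a (f ∘ suc) g n))
      (sym (ℙ.*-distribˡ-+ a _ _))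

    *ₛ-assoc : ∀ f g h → (f *ₛ g) *ₛ h ≈ f *ₛ (g *ₛ h)
    *ₛ-assoc f g h zero    = ℙ.*-assoc (f 0) _ _
    *ₛ-assoc f g h (suc n) = begin
      f 0 ⊗ g 0 ⊗ h (suc n) ⊕ ((f 0 ·ₛ (g ∘ suc) +ₛ (f ∘ suc) *ₛ g) *ₛ h) n
        ≡⟨ cong₂ _⊕_ (ℙ.*-assoc (f 0) _ _) (trans (*ₛ-distribʳ h (f 0 ·ₛ (g ∘ suc)) ((f ∘ suc) *ₛ g) n)
             (cong₂ _⊕_ (·ₛ-*ₛ-assoc (f 0) (g ∘ suc) h n) (*ₛ-assoc (f ∘ suc) g h n))) ⟩
      f 0 ⊗ (g 0 ⊗ h (suc n)) ⊕ (f 0 ⊗ ((g ∘ suc) *ₛ h) n ⊕ ((f ∘ suc) *ₛ (g *ₛ h)) n)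
        ≡⟨ ℙ.+-assoc (f 0 ⊗ _) _ _ ⟨
      f 0 ⊗ (g 0 ⊗ h (suc n)) ⊕ f 0 ⊗ ((g ∘ suc) *ₛ h) n ⊕ ((f ∘ suc) *ₛ (g *ₛ h)) n
        ≡⟨ cong (_⊕ ((f ∘ suc) *ₛ (g *ₛ h)) n) (ℙ.*-distribˡ-+ (f 0) _ _) ⟨
      f 0 ⊗ (g *ₛ h) (suc n) ⊕ ((f ∘ suc) *ₛ (g *ₛ h)) n ∎
      where open ≡-Reasoning

    -- The mirror image of the defining recursion, splitting the second factor instead;
    -- commutativity follows by matching the two.
    *ₛ-sucʳ : ∀ f g n → (f *ₛ g) (suc n) ≡ f (suc n) ⊗ g 0 ⊕ (f *ₛ (g ∘ suc)) n
    *ₛ-sucʳ f g zero    = ℙ.+-comm (f 0 ⊗ g 1) _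
    *ₛ-sucʳ f g (suc n) = trans (cong (f 0 ⊗ g (suc (suc n)) ⊕_) (*ₛ-sucʳ (f ∘ suc) g n))
      (x∙yz≈y∙xz (f 0 ⊗ g (suc (suc n))) (f (suc (suc n)) ⊗ g 0) (((f ∘ suc) *ₛ (g ∘ suc)) n))
      where open CommutativeSemigroupProperties ℙ.+-commutativeSemigroup

    *ₛ-comm : ∀ f g → f *ₛ g ≈ g *ₛ f
    *ₛ-comm f g zero    = ℙ.*-comm (f 0) _
    *ₛ-comm f g (suc n) = trans (cong₂ _⊕_ (ℙ.*-comm (f 0) _) (*ₛ-comm (f ∘ suc) g n))
      (sym (*ₛ-sucʳ g f n))

  ℙ⟦X⟧-commutativeSemiring : CommutativeSemiring 0ℓ 0ℓ
  ℙ⟦X⟧-commutativeSemiring = record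
    { Carrier = ℙ⟦X⟧ ; _≈_ = _≈_ ; _+_ = _+ₛ_ ; _*_ = _*ₛ_ ; 0# = 0ₛ ; 1# = 1ₛ
    ; isCommutativeSemiring = IsCommutativeSemiringˡ.isCommutativeSemiring record
      { +-isCommutativeMonoid = IsCommutativeMonoidˡ.isCommutativeMonoid record
        { isSemigroup = record
          { isMagma = record { isEquivalence = isEquivalence ; ∙-cong = λ p q n → cong₂ _⊕_ (p n) (q n) }
          ; assoc = λ f g h n → ℙ.+-assoc (f n) (g n) (h n) }
        ; identityˡ = λ f n → refl
        ; comm = λ f g n → ℙ.+-comm (f n) (g n) }
      ; *-isCommutativeMonoid = IsCommutativeMonoidˡ.isCommutativeMonoid record
        { isSemigroup = record
          { isMagma = record { isEquivalence = isEquivalence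
                             ; ∙-cong = λ p q n → *ₛ-cong-≤ n (λ _ → p _) (λ _ → q _) ℕ.≤-refl }
          ; assoc = *ₛ-assoc }
        ; identityˡ = *ₛ-identityˡ
        ; comm = *ₛ-comm }
      ; distribʳ = *ₛ-distribʳ
      ; zeroˡ = *ₛ-zeroˡ } }
    where
    isEquivalence : IsEquivalence _≈_
    isEquivalence = record { refl = λ _ → refl ; sym = λ p n → sym (p n) ; trans = λ p q n → trans (p n) (q n) }

  private
    1+1≈0 : CharacteristicTwo ℙ⟦X⟧-commutativeSemiring
    1+1≈0 zero    = refl
    1+1≈0 (suc n) = refl

  open CommutativeSemiring ℙ⟦X⟧-commutativeSemiring
    using (_+_; _*_; 0#; 1#; semiring; setoid; +-cong; +-congʳ; +-congˡ; +-assoc;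
           *-cong; *-congʳ; *-congˡ; *-assoc; *-identityʳ; *-identityˡ)
    renaming (refl to ≈-refl; sym to ≈-sym; trans to ≈-trans)
  open CommutativeExp ℙ⟦X⟧-commutativeSemiring using (^-distrib-*)
  open Exp semiring using (_^_; ^-congˡ; ^-homo-*; ^-assocʳ)
  open CharTwo ℙ⟦X⟧-commutativeSemiring 1+1≈0

  module ≈-Reasoning = SetoidReasoning setoid

  *-cong-≈[] : ∀ {N f f′ g g′} → f ≈[ N ] f′ → g ≈[ N ] g′ → f * g ≈[ N ] f′ * g′
  *-cong-≈[] {N} = *ₛ-cong-≤ N

  ^-cong-≈[] : ∀ {N f g} k → f ≈[ N ] g → f ^ k ≈[ N ] g ^ k
  ^-cong-≈[] zero    p _ = refl
  ^-cong-≈[] {N} {f} {g} (suc k) p = *-cong-≈[] {N} {f} {g} {f ^ k} {g ^ k} p (^-cong-≈[] {N} {f} {g} k p)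

  -- A series with constant term 1 is a unit. Constant terms agree in degree 0; removing the common
  -- multiple of h reduces the claim to the tails, one degree lower.
  *-cancelʳ-≈[] : ∀ N f g {h} → h 0 ≡ 1ℙ → f * h ≈[ N ] g * h → f ≈[ N ] g
  *-cancelʳ-≈[] N f g {h} h₀ p {n = zero} _ = begin
    f 0        ≡⟨ ℙ.*-identityʳ (f 0) ⟨
    f 0 ⊗ 1ℙ   ≡⟨ cong (f 0 ⊗_) h₀ ⟨
    f 0 ⊗ h 0  ≡⟨ p z≤n ⟩
    g 0 ⊗ h 0  ≡⟨ cong (g 0 ⊗_) h₀ ⟩
    g 0 ⊗ 1ℙ   ≡⟨ ℙ.*-identityʳ (g 0) ⟩
    g 0        ∎
    where open ≡-Reasoning
  *-cancelʳ-≈[] (suc N) f g {h} h₀ p {n = suc n} (s≤s l) =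
    *-cancelʳ-≈[] N (f ∘ suc) (g ∘ suc) h₀ tails l
    where
    tails : (f ∘ suc) * h ≈[ N ] (g ∘ suc) * h
    tails {m} m≤N = ℙ.+-cancelˡ-≡ (f 0 ⊗ h (suc m)) _ _ (trans (p (s≤s m≤N))
      (cong (λ a → a ⊗ h (suc m) ⊕ ((g ∘ suc) * h) m)
        (sym (*-cancelʳ-≈[] (suc N) f g h₀ p z≤n))))

  X : ℙ⟦X⟧
  X zero    = 0ℙ
  X (suc n) = 1# n

  X*-suc : ∀ f n → (X * f) (suc n) ≡ f n
  X*-suc f n = *-identityˡ f n

  X^*-< : ∀ k f {n} → n < k → (X ^ k * f) n ≡ 0ℙ
  X^*-< (suc k) f {n} n<k = trans (*-assoc X (X ^ k) f n) (go n n<k)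
    where
    go : ∀ n → n < suc k → (X * (X ^ k * f)) n ≡ 0ℙ
    go zero    _         = refl
    go (suc n) (s≤s n<k) = trans (X*-suc (X ^ k * f) n) (X^*-< k f n<k)

  X^*-+ : ∀ k f n → (X ^ k * f) (k ℕ.+ n) ≡ f n
  X^*-+ zero    f n = *-identityˡ f n
  X^*-+ (suc k) f n = trans (*-assoc X (X ^ k) f (suc (k ℕ.+ n)))
    (trans (X*-suc (X ^ k * f) (k ℕ.+ n)) (X^*-+ k f n))

  X^-diagonal : ∀ k → (X ^ k) k ≡ 1ℙ
  X^-diagonal zero    = refl
  X^-diagonal (suc k) = trans (X*-suc (X ^ k) k) (X^-diagonal k)

  X^-off-diagonal : ∀ k n → k ≢ n → (X ^ k) n ≡ 0ℙ
  X^-off-diagonal zero    zero    k≢n = ⊥-elim (k≢n refl)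
  X^-off-diagonal zero    (suc n) k≢n = refl
  X^-off-diagonal (suc k) zero    k≢n = refl
  X^-off-diagonal (suc k) (suc n) k≢n = trans (X*-suc (X ^ k) n) (X^-off-diagonal k n (k≢n ∘ cong suc))

  -- Together with `square-odd` this is f(X)² = f(X²): the mixed products f(i) f(j) and f(j) f(i)
  -- cancel, and only the diagonal remains.
  square-even : ∀ f n → (f * f) (n ℕ.+ n) ≡ f n
  square-odd  : ∀ f n → (f * f) (suc (n ℕ.+ n)) ≡ 0ℙ

  -- The outermost pair f(0) f(n+2) and f(n+2) f(0) cancels; the rest is the square of the shifted
  -- series.
  square-tail : ∀ f n → (f * f) (suc (suc n)) ≡ ((f ∘ suc) * (f ∘ suc)) n
  square-tail f n = begin
    f 0 ⊗ f (suc (suc n)) ⊕ ((f ∘ suc) * f) (suc n)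
      ≡⟨ cong (f 0 ⊗ f (suc (suc n)) ⊕_) (*ₛ-sucʳ (f ∘ suc) f n) ⟩
    f 0 ⊗ f (suc (suc n)) ⊕ (f (suc (suc n)) ⊗ f 0 ⊕ t)
      ≡⟨ ℙ.+-assoc (f 0 ⊗ f (suc (suc n))) _ t ⟨
    f 0 ⊗ f (suc (suc n)) ⊕ f (suc (suc n)) ⊗ f 0 ⊕ t
      ≡⟨ cong (λ a → a ⊕ f (suc (suc n)) ⊗ f 0 ⊕ t) (ℙ.*-comm (f 0) _) ⟩
    f (suc (suc n)) ⊗ f 0 ⊕ f (suc (suc n)) ⊗ f 0 ⊕ t
      ≡⟨ cong (_⊕ t) (ℙ.p+p≡0ℙ (f (suc (suc n)) ⊗ f 0)) ⟩
    t ∎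
    where
    open ≡-Reasoning
    t = ((f ∘ suc) * (f ∘ suc)) n

  square-even f zero    = ℙ.*-idem (f 0)
  square-even f (suc n) rewrite ℕ.+-suc n n = trans (square-tail f (n ℕ.+ n)) (square-even (f ∘ suc) n)

  square-odd f zero    = trans (cong (_⊕ f 1 ⊗ f 0) (ℙ.*-comm (f 0) (f 1))) (ℙ.p+p≡0ℙ (f 1 ⊗ f 0))
  square-odd f (suc n) rewrite ℕ.+-suc n n = trans (square-tail f (suc (n ℕ.+ n))) (square-odd (f ∘ suc) n)

  parity-⊛ : ∀ f g → parity ∘ (f ⊛ g) ≈ (parity ∘ f) * (parity ∘ g)
  parity-⊛ f g n = go n f
    where
    go : ∀ n f → parity ((f ⊛ g) n) ≡ ((parity ∘ f) * (parity ∘ g)) n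
    go zero    f = trans (cong parity (ℕ.+-identityʳ (f 0 ℕ.* g 0))) (ℙ.*-homo-* (f 0) (g 0))
    go (suc n) f = begin
      parity (f 0 ℕ.* g (suc n) ℕ.+ sum (map (λ i → f i ℕ.* g (suc n ∸ i)) (applyUpTo suc (suc n))))
        ≡⟨ ℙ.+-homo-+ (f 0 ℕ.* g (suc n)) _ ⟩
      parity (f 0 ℕ.* g (suc n)) ⊕ parity (sum (map (λ i → f i ℕ.* g (suc n ∸ i)) (applyUpTo suc (suc n))))
        ≡⟨ cong₂ (λ a xs → a ⊕ parity (sum xs)) (ℙ.*-homo-* (f 0) (g (suc n)))
             (trans (map-applyUpTo suc (λ i → f i ℕ.* g (suc n ∸ i)) (suc n))
                    (sym (map-upTo (λ i → f (suc i) ℕ.* g (n ∸ i)) (suc n)))) ⟩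
      parity (f 0) ⊗ parity (g (suc n)) ⊕ parity (((f ∘ suc) ⊛ g) n)
        ≡⟨ cong (parity (f 0) ⊗ parity (g (suc n)) ⊕_) (go n (f ∘ suc)) ⟩
      ((parity ∘ f) * (parity ∘ g)) (suc n) ∎
      where open ≡-Reasoning

  -- Gauss's identity for power series modulo 2

  open Shanks ℙ⟦X⟧-commutativeSemiring 1+1≈0 X

  -- A truncation of P, which modulo 2 is also Euler's product ∏ (1 - Xᵏ).
  eulerProduct : ℕ → ℙ⟦X⟧
  eulerProduct zero    = 1#
  eulerProduct (suc n) = eulerProduct n * (1# + X ^ suc n)

  eulerProduct-constant : ∀ n → eulerProduct n 0 ≡ 1ℙ
  eulerProduct-constant zero    = refl
  eulerProduct-constant (suc n) = cong (_⊗ 1ℙ) (eulerProduct-constant n)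

  X^*-≈[]0 : ∀ {N} k f → N < k → X ^ k * f ≈[ N ] 0#
  X^*-≈[]0 k f N<k n≤N = X^*-< k f (ℕ.≤-<-trans n≤N N<k)

  eulerProduct-≈[] : ∀ N k → eulerProduct (k ℕ.+ N) ≈[ N ] eulerProduct N
  eulerProduct-≈[] N zero    _ = refl
  eulerProduct-≈[] N (suc k) {n} n≤N = begin
    (eulerProduct (k ℕ.+ N) * (1# + X ^ suc (k ℕ.+ N))) n
      ≡⟨ solve 2 (λ e y → e :* (con 1ℙ :+ y) := e :+ y :* e) ≈-refl
           (eulerProduct (k ℕ.+ N)) (X ^ suc (k ℕ.+ N)) n ⟩
    eulerProduct (k ℕ.+ N) n ⊕ (X ^ suc (k ℕ.+ N) * eulerProduct (k ℕ.+ N)) n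
      ≡⟨ cong₂ _⊕_ (eulerProduct-≈[] N k n≤N)
           (X^*-≈[]0 (suc (k ℕ.+ N)) (eulerProduct (k ℕ.+ N)) (s≤s (ℕ.m≤n+m N k)) n≤N) ⟩
    eulerProduct N n ⊕ 0ℙ
      ≡⟨ ℙ.+-identityʳ _ ⟩
    eulerProduct N n ∎
    where open ≡-Reasoning

  -- Factor by factor, 1 + X^(2k) = (1 + Xᵏ)² in characteristic two.
  evenFactors≈eulerProduct² : ∀ n → evenFactors n ≈ eulerProduct n * eulerProduct n
  evenFactors≈eulerProduct² zero    = ≈-sym (*-identityˡ 1#)
  evenFactors≈eulerProduct² (suc n) = begin
    evenFactors n * (1# + (X * X) ^ suc n)
      ≈⟨ *-cong (evenFactors≈eulerProduct² n) (+-congˡ {1#} (^-distrib-* X X (suc n))) ⟩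
    eulerProduct n * eulerProduct n * (1# + X ^ suc n * X ^ suc n)
      ≈⟨ solve 2 (λ e y → let 1' = con 1ℙ in
           e :* e :* (1' :+ y :* y) := (e :* (1' :+ y)) :* (e :* (1' :+ y)))
         ≈-refl (eulerProduct n) (X ^ suc n) ⟩
    eulerProduct (suc n) * eulerProduct (suc n) ∎
    where open ≈-Reasoning

  [X*X]^ : ∀ n → (X * X) ^ n ≈ X ^ (n ℕ.+ n)
  [X*X]^ n = ≈-trans (^-distrib-* X X n) (≈-sym (^-homo-* X n n))

  eulerProduct-double : ∀ n → eulerProduct (n ℕ.+ n) ≈ oddFactors n * evenFactors n
  eulerProduct-double zero    = ≈-sym (*-identityˡ 1#)
  eulerProduct-double (suc n) rewrite ℕ.+-suc n n = begin
    eulerProduct (n ℕ.+ n) * (1# + X * X ^ (n ℕ.+ n)) * (1# + X * (X * X ^ (n ℕ.+ n)))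
      ≈⟨ *-cong (*-cong (eulerProduct-double n) (+-congˡ {1#} (*-congˡ {X} (≈-sym ([X*X]^ n)))))
           (+-congˡ {1#} (≈-trans (≈-sym (*-assoc X X (X ^ (n ℕ.+ n)))) (*-congˡ {X * X} (≈-sym ([X*X]^ n))))) ⟩
    d * e * (1# + X * w) * (1# + X * X * w)
      ≈⟨ solve 4 (λ d e x y → d :* e :* x :* y := d :* x :* (e :* y)) ≈-refl d e (1# + X * w) (1# + X * X * w) ⟩
    d * (1# + X * w) * (e * (1# + X * X * w)) ∎
    where
    open ≈-Reasoning
    d = oddFactors n
    e = evenFactors n
    w = (X * X) ^ n

  ψ-partial : ℕ → ℙ⟦X⟧
  ψ-partial zero    = 0#
  ψ-partial (suc K) = ψ-partial K + X ^ T K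

  parity-count : ∀ K m → parity (length (filter (λ k → T k ≟ m) (upTo K))) ≡ ψ-partial K m
  parity-count zero    m = refl
  parity-count (suc K) m = begin
    parity (length (filter T≟m (upTo (suc K))))
      ≡⟨ cong (parity ∘ length ∘ filter T≟m) (upTo-∷ʳ K) ⟨
    parity (length (filter T≟m (upTo K ∷ʳ K)))
      ≡⟨ cong (parity ∘ length) (filter-++ T≟m (upTo K) (K ∷ [])) ⟩
    parity (length (filter T≟m (upTo K) ++ filter T≟m (K ∷ [])))
      ≡⟨ cong parity (length-++ (filter T≟m (upTo K))) ⟩
    parity (length (filter T≟m (upTo K)) ℕ.+ length (filter T≟m (K ∷ [])))
      ≡⟨ ℙ.+-homo-+ (length (filter T≟m (upTo K))) _ ⟩
    parity (length (filter T≟m (upTo K))) ⊕ parity (length (filter T≟m (K ∷ [])))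
      ≡⟨ cong₂ _⊕_ (parity-count K m) summand ⟩
    ψ-partial K m ⊕ (X ^ T K) m ∎
    where
    open ≡-Reasoning
    T≟m = λ k → T k ≟ m

    summand : parity (length (filter T≟m (K ∷ []))) ≡ (X ^ T K) m
    summand with T K ≟ m
    ... | yes refl = trans (cong (parity ∘ length) (filter-accept T≟m {K} {[]} refl)) (sym (X^-diagonal (T K)))
    ... | no T≢m   = trans (cong (parity ∘ length) (filter-reject T≟m {K} {[]} T≢m)) (sym (X^-off-diagonal (T K) m T≢m))

  ψ-partial-+ : ∀ K d {m} → m < K → ψ-partial (d ℕ.+ K) m ≡ ψ-partial K m
  ψ-partial-+ K zero    m<K = refl
  ψ-partial-+ K (suc d) {m} m<K = begin
    ψ-partial (d ℕ.+ K) m ⊕ (X ^ T (d ℕ.+ K)) m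
      ≡⟨ cong₂ _⊕_ (ψ-partial-+ K d m<K) (X^-off-diagonal (T (d ℕ.+ K)) m
           (λ { refl → ℕ.<⇒≱ m<K (ℕ.≤-trans (ℕ.m≤n+m K d) (k≤T (d ℕ.+ K))) })) ⟩
    ψ-partial K m ⊕ 0ℙ
      ≡⟨ ℙ.+-identityʳ _ ⟩
    ψ-partial K m ∎
    where open ≡-Reasoning

  -- The cut-off 2N + 1 is chosen to match `triangularSum N`, whose exponents are T 0, ..., T (2N).
  -- Later summands lie beyond degree N because k ≤ T k.
  parity-ψ≈[] : ∀ N → parity ∘ ψ ≈[ N ] ψ-partial (suc (N ℕ.+ N))
  parity-ψ≈[] N {m} m≤N = begin
    parity (ψ m)                   ≡⟨ parity-count (suc m) m ⟩
    ψ-partial (suc m) m            ≡⟨ ψ-partial-+ (suc m) (N ℕ.+ (N ℕ.∸ m)) (ℕ.n<1+n m) ⟨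
    ψ-partial (N ℕ.+ (N ℕ.∸ m) ℕ.+ suc m) m ≡⟨ cong (λ K → ψ-partial K m) K-eq ⟩
    ψ-partial (suc (N ℕ.+ N)) m    ∎
    where
    open ≡-Reasoning
    K-eq : N ℕ.+ (N ℕ.∸ m) ℕ.+ suc m ≡ suc (N ℕ.+ N)
    K-eq = trans (ℕ.+-suc _ m) (cong suc (trans (ℕ.+-assoc N _ m) (cong (N ℕ.+_) (ℕ.m∸n+n≡m m≤N))))

  X*[X*X]^ : ∀ n → X * (X * X) ^ n ≈ X ^ suc (n ℕ.+ n)
  X*[X*X]^ n = *-congˡ {X} ([X*X]^ n)

  triangularSum≈ψ-partial : ∀ n → triangularSum n ≈ ψ-partial (suc (n ℕ.+ n))
  triangularSum≈ψ-partial zero    n = refl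
  triangularSum≈ψ-partial (suc n) rewrite ℕ.+-suc n n = begin
    triangularSum n + ((X * (X * X) ^ n) ^ suc n + (X * (X * X) ^ suc n) ^ suc n)
      ≈⟨ +-cong (triangularSum≈ψ-partial n) (+-cong
           (≈-trans (power n) (exponent (sym (T-suc-double n))))
           (≈-trans (power (suc n)) (exponent T-eq))) ⟩
    ψ-partial (suc (n ℕ.+ n)) + (X ^ T (suc (n ℕ.+ n)) + X ^ T (suc n ℕ.+ suc n))
      ≈⟨ +-assoc (ψ-partial (suc (n ℕ.+ n))) _ _ ⟨
    ψ-partial (suc (n ℕ.+ n)) + X ^ T (suc (n ℕ.+ n)) + X ^ T (suc n ℕ.+ suc n)
      ≈⟨ +-congˡ {ψ-partial (suc (suc (n ℕ.+ n)))} (exponent (cong T (ℕ.+-suc (suc n) n))) ⟩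
    ψ-partial (suc (suc (suc (n ℕ.+ n)))) ∎
    where
    open ≈-Reasoning
    exponent : ∀ {i j} → i ≡ j → X ^ i ≈ X ^ j
    exponent refl _ = refl

    T-eq : suc (suc n ℕ.+ suc n) ℕ.* suc n ≡ T (suc n ℕ.+ suc n)
    T-eq = trans (ℕ.*-comm (suc (suc n ℕ.+ suc n)) (suc n))
      (trans (cong (suc n ℕ.*_) (ℕ.+-comm 1 (suc n ℕ.+ suc n))) (sym (T-double (suc n))))

    power : ∀ k → (X * (X * X) ^ k) ^ suc n ≈ X ^ (suc (k ℕ.+ k) ℕ.* suc n)
    power k = ≈-trans (^-congˡ (suc n) (X*[X*X]^ k)) (^-assocʳ X (suc (k ℕ.+ k)) (suc n))

  -- Modulo X^(N+1), P may be replaced by `eulerProduct (N + N)`, which splits as odd factors d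
  -- times even factors e. Then ψ P = (d S) e = e² = P⁴, since the remainder in d S = e + X^(2N+1) r
  -- lies beyond degree N.
  ψ*eulerProduct : ∀ N → (parity ∘ ψ) * eulerProduct N ≈[ N ] eulerProduct N ^ 4
  ψ*eulerProduct N {m} m≤N with r , eq ← triangularSum-product N = begin
    ((parity ∘ ψ) * P) m
      ≡⟨ *-cong-≈[] {N} {parity ∘ ψ} {S} {P} {eulerProduct (N ℕ.+ N)}
           (λ l → trans (parity-ψ≈[] N l) (sym (triangularSum≈ψ-partial N _)))
           (λ l → sym (eulerProduct-≈[] N N l)) m≤N ⟩
    (S * eulerProduct (N ℕ.+ N)) m
      ≡⟨ *-congˡ {S} (eulerProduct-double N) m ⟩
    (S * (d * e)) m
      ≡⟨ solve 3 (λ s d e → s :* (d :* e) := (d :* s) :* e) ≈-refl S d e m ⟩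
    (d * S * e) m
      ≡⟨ *-congʳ {e} (≈-trans eq (+-congˡ {e} (*-congʳ {r} (X*[X*X]^ N)))) m ⟩
    ((e + X ^ suc (N ℕ.+ N) * r) * e) m
      ≡⟨ *-cong-≈[] {N} {e + X ^ suc (N ℕ.+ N) * r} {e} {e} {e}
           (λ {k} l → trans (cong (e k ⊕_) (X^*-≈[]0 (suc (N ℕ.+ N)) r (s≤s (ℕ.m≤n+m N N)) l))
                            (ℙ.+-identityʳ (e k)))
           (λ _ → refl) m≤N ⟩
    (e * e) m
      ≡⟨ *-cong {e} {P * P} (evenFactors≈eulerProduct² N) (evenFactors≈eulerProduct² N) m ⟩
    (P * P * (P * P)) m
      ≡⟨ solve 1 (λ p → p :* p :* (p :* p) := p :^ 4) ≈-refl P m ⟩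
    (P ^ 4) m ∎
    where
    open ≡-Reasoning
    P = eulerProduct N
    S = triangularSum N
    d = oddFactors N
    e = evenFactors N

  n*4≡ : ∀ n → n ℕ.* 4 ≡ n ℕ.+ n ℕ.+ (n ℕ.+ n)
  n*4≡ = ℕSolver.solve-∀

  -- Modulo 2, f(q⁴) = f(q)⁴, by applying f(X)² = f(X²) twice.
  parity-⟨q^4⟩ : ∀ f → parity ∘ (f ⟨q^ 4 ⟩) ≈ (parity ∘ f) ^ 4
  parity-⟨q^4⟩ f n = trans (lemma n) (solve 1 (λ F → (F :* F) :* (F :* F) := F :^ 4) ≈-refl F n)
    where
    F = parity ∘ f

    nonmultiple : ∀ n → 4 ∤ n → (F * F * (F * F)) n ≡ 0ℙ
    nonmultiple n 4∤n with halves n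
    ... | odd m  = square-odd (F * F) m
    ... | even m with halves m
    ...   | odd k  = trans (square-even (F * F) (suc (k ℕ.+ k))) (square-odd F k)
    ...   | even k = ⊥-elim (4∤n (divides k (sym (n*4≡ k))))

    lemma : ∀ n → parity ((f ⟨q^ 4 ⟩) n) ≡ (F * F * (F * F)) n
    lemma n with 4 ∣? n
    ... | yes (divides-refl m) = begin
      parity ((f ⟨q^ 4 ⟩) (m ℕ.* 4))            ≡⟨ cong parity (⟨q^⟩-multiple f 4 m) ⟩
      F m                                       ≡⟨ square-even F m ⟨
      (F * F) (m ℕ.+ m)                         ≡⟨ square-even (F * F) (m ℕ.+ m) ⟨
      (F * F * (F * F)) (m ℕ.+ m ℕ.+ (m ℕ.+ m)) ≡⟨ cong (F * F * (F * F)) (n*4≡ m) ⟨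
      (F * F * (F * F)) (m ℕ.* 4)               ∎
      where open ≡-Reasoning
    ... | no 4∤n = trans (cong parity (⟨q^⟩-nonmultiple f 4 4∤n)) (sym (nonmultiple n 4∤n))

  -- The generating function of regular partitions modulo 2

  boundedSeries : ℕ → ℕ → ℙ⟦X⟧
  boundedSeries ℓ m n = parity (bounded ℓ m n)

  -- The numerator of the generating function ∏ (1 - q^(ℓk)) / ∏ (1 - qᵏ), truncated and reduced
  -- modulo 2.
  multiplesProduct : ℕ → ℕ → ℙ⟦X⟧
  multiplesProduct ℓ zero    = 1#
  multiplesProduct ℓ (suc m) =
    multiplesProduct ℓ m * (if does (ℓ ∣? suc m) then 1# + X ^ suc m else 1#)

  boundedSeries-skip : ∀ ℓ m → ℓ ∣ suc m → boundedSeries ℓ (suc m) ≈ boundedSeries ℓ m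
  boundedSeries-skip ℓ m ℓ∣1+m n = cong parity (bounded-skip ℓ m n (inj₁ ℓ∣1+m))

  -- In characteristic two, multiplying by 1 + X^(m+1) subtracts the partitions that contain m + 1:
  -- it undoes the geometric series of that part.
  boundedSeries-use : ∀ ℓ m → ℓ ∤ suc m → boundedSeries ℓ (suc m) * (1# + X ^ suc m) ≈ boundedSeries ℓ m
  boundedSeries-use ℓ m ℓ∤1+m n = trans
    (solve 2 (λ c y → c :* (con 1ℙ :+ y) := c :+ y :* c) ≈-refl (boundedSeries ℓ (suc m)) (X ^ suc m) n)
    (coefficient n)
    where
    c = boundedSeries ℓ (suc m)
    open ≡-Reasoning

    coefficient : ∀ n → c n ⊕ (X ^ suc m * c) n ≡ boundedSeries ℓ m n
    coefficient n with ℕ.≤-<-connex (suc m) n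
    ... | inj₂ n<1+m = begin
      c n ⊕ (X ^ suc m * c) n
        ≡⟨ cong₂ _⊕_ (cong parity (bounded-skip ℓ m n (inj₂ n<1+m))) (X^*-< (suc m) c n<1+m) ⟩
      boundedSeries ℓ m n ⊕ 0ℙ
        ≡⟨ ℙ.+-identityʳ _ ⟩
      boundedSeries ℓ m n ∎
    ... | inj₁ 1+m≤n with k , refl ← ℕ.m≤n⇒∃[o]m+o≡n 1+m≤n = begin
      c (suc m ℕ.+ k) ⊕ (X ^ suc m * c) (suc m ℕ.+ k)
        ≡⟨ cong₂ _⊕_ (trans (cong parity (bounded-use ℓ m k ℓ∤1+m)) (ℙ.+-homo-+ (bounded ℓ m (suc m ℕ.+ k)) _))
             (X^*-+ (suc m) c k) ⟩
      boundedSeries ℓ m (suc m ℕ.+ k) ⊕ c k ⊕ c k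
        ≡⟨ ℙ.+-assoc (boundedSeries ℓ m (suc m ℕ.+ k)) (c k) (c k) ⟩
      boundedSeries ℓ m (suc m ℕ.+ k) ⊕ (c k ⊕ c k)
        ≡⟨ cong (boundedSeries ℓ m (suc m ℕ.+ k) ⊕_) (ℙ.p+p≡0ℙ (c k)) ⟩
      boundedSeries ℓ m (suc m ℕ.+ k) ⊕ 0ℙ
        ≡⟨ ℙ.+-identityʳ _ ⟩
      boundedSeries ℓ m (suc m ℕ.+ k) ∎

  boundedSeries-product : ∀ ℓ m → boundedSeries ℓ m * eulerProduct m ≈ multiplesProduct ℓ m
  boundedSeries-product ℓ zero    = ≈-trans (*-identityʳ (boundedSeries ℓ 0))
    λ { zero → refl ; (suc n) → cong parity (bounded-zero ℓ n) }
  boundedSeries-product ℓ (suc m) with ℓ ∣? suc m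
  ... | yes ℓ∣1+m = begin
    boundedSeries ℓ (suc m) * (eulerProduct m * (1# + X ^ suc m))
      ≈⟨ *-congʳ {eulerProduct m * (1# + X ^ suc m)} (boundedSeries-skip ℓ m ℓ∣1+m) ⟩
    boundedSeries ℓ m * (eulerProduct m * (1# + X ^ suc m))
      ≈⟨ *-assoc (boundedSeries ℓ m) (eulerProduct m) (1# + X ^ suc m) ⟨
    boundedSeries ℓ m * eulerProduct m * (1# + X ^ suc m)
      ≈⟨ *-congʳ {1# + X ^ suc m} (boundedSeries-product ℓ m) ⟩
    multiplesProduct ℓ m * (1# + X ^ suc m) ∎
    where open ≈-Reasoning
  ... | no ℓ∤1+m = begin
    boundedSeries ℓ (suc m) * (eulerProduct m * (1# + X ^ suc m))
      ≈⟨ solve 3 (λ c e y → c :* (e :* y) := (c :* y) :* e) ≈-refl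
           (boundedSeries ℓ (suc m)) (eulerProduct m) (1# + X ^ suc m) ⟩
    boundedSeries ℓ (suc m) * (1# + X ^ suc m) * eulerProduct m
      ≈⟨ *-congʳ {eulerProduct m} (boundedSeries-use ℓ m ℓ∤1+m) ⟩
    boundedSeries ℓ m * eulerProduct m
      ≈⟨ boundedSeries-product ℓ m ⟩
    multiplesProduct ℓ m
      ≈⟨ *-identityʳ (multiplesProduct ℓ m) ⟨
    multiplesProduct ℓ m * 1# ∎
    where open ≈-Reasoning

  multiplesProduct-skip : ∀ ℓ r j → j < ℓ → multiplesProduct ℓ (j ℕ.+ r ℕ.* ℓ) ≈ multiplesProduct ℓ (r ℕ.* ℓ)
  multiplesProduct-skip ℓ r zero    _     _ = refl
  multiplesProduct-skip ℓ r (suc j) 1+j<ℓ with ℓ ∣? suc (j ℕ.+ r ℕ.* ℓ)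
  ... | yes ℓ∣ = ⊥-elim (ℕ.<⇒≱ 1+j<ℓ (∣⇒≤ (∣m+n∣m⇒∣n (subst (ℓ ∣_) (ℕ.+-comm (suc j) (r ℕ.* ℓ)) ℓ∣) (n∣m*n r))))
  ... | no _   = ≈-trans (*-identityʳ (multiplesProduct ℓ (j ℕ.+ r ℕ.* ℓ)))
                         (multiplesProduct-skip ℓ r j (ℕ.<-trans (ℕ.n<1+n j) 1+j<ℓ))

  multiplesProduct-use : ∀ ℓ m → ℓ ∣ suc m → multiplesProduct ℓ (suc m) ≡ multiplesProduct ℓ m * (1# + X ^ suc m)
  multiplesProduct-use ℓ m ℓ∣1+m with ℓ ∣? suc m
  ... | yes _   = refl
  ... | no ℓ∤1+m = ⊥-elim (ℓ∤1+m ℓ∣1+m)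

  frobenius : ∀ k f → 1# + f ^ (2 ℕ.^ k) ≈ (1# + f) ^ (2 ℕ.^ k)
  frobenius zero    f = solve 1 (λ y → con 1ℙ :+ y :^ 1 := (con 1ℙ :+ y) :^ 1) ≈-refl f
  frobenius (suc k) f = begin
    1# + f ^ (2 ℕ.* 2 ℕ.^ k)   ≈⟨ +-congˡ {1#} (^-assocʳ f 2 (2 ℕ.^ k)) ⟨
    1# + (f ^ 2) ^ (2 ℕ.^ k)   ≈⟨ frobenius k (f ^ 2) ⟩
    (1# + f ^ 2) ^ (2 ℕ.^ k)   ≈⟨ ^-congˡ (2 ℕ.^ k)
                                  (solve 1 (λ y → con 1ℙ :+ y :^ 2 := (con 1ℙ :+ y) :^ 2) ≈-refl f) ⟩
    ((1# + f) ^ 2) ^ (2 ℕ.^ k) ≈⟨ ^-assocʳ (1# + f) 2 (2 ℕ.^ k) ⟩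
    (1# + f) ^ (2 ℕ.* 2 ℕ.^ k) ∎
    where open ≈-Reasoning

  -- Here 16 = 2⁴ matters: the factor 1 + X^(16k) is (1 + Xᵏ)¹⁶ by four squarings.
  multiplesProduct-16 : ∀ r → multiplesProduct 16 (r ℕ.* 16) ≈ eulerProduct r ^ 16
  multiplesProduct-16 zero    = solve 0 (con 1ℙ := con 1ℙ :^ 16) ≈-refl
  multiplesProduct-16 (suc r) = begin
    multiplesProduct 16 (suc r ℕ.* 16)
      ≡⟨ multiplesProduct-use 16 (15 ℕ.+ r ℕ.* 16) (n∣m*n (suc r)) ⟩
    multiplesProduct 16 (15 ℕ.+ r ℕ.* 16) * (1# + X ^ (suc r ℕ.* 16))
      ≈⟨ *-cong (≈-trans (multiplesProduct-skip 16 r 15 (ℕ.n<1+n 15)) (multiplesProduct-16 r))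
           (+-congˡ {1#} (≈-sym (^-assocʳ X (suc r) 16))) ⟩
    eulerProduct r ^ 16 * (1# + (X ^ suc r) ^ 16)
      ≈⟨ *-congˡ {eulerProduct r ^ 16} (frobenius 4 (X ^ suc r)) ⟩
    eulerProduct r ^ 16 * (1# + X ^ suc r) ^ 16
      ≈⟨ ^-distrib-* (eulerProduct r) (1# + X ^ suc r) 16 ⟨
    eulerProduct (suc r) ^ 16 ∎
    where
    open ≈-Reasoning

  -- The parts are bounded by 16 N, not N, so that the numerator contains exactly N multiples of 16
  -- and equals `eulerProduct N ^ 16` without truncation.
  b₁₆*eulerProduct : ∀ N → (parity ∘ b 16) * eulerProduct N ≈[ N ] eulerProduct N ^ 16
  b₁₆*eulerProduct N {m} m≤N = begin
    ((parity ∘ b 16) * eulerProduct N) m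
      ≡⟨ *-cong-≈[] {N} {parity ∘ b 16} {boundedSeries 16 (N ℕ.* 16)} {eulerProduct N} {eulerProduct (N ℕ.* 16)}
           (λ l → cong parity (sym (bounded≡b 16 (ℕ.≤-trans l (ℕ.m≤m*n N 16)))))
           (λ {k} l → sym (subst (λ M → eulerProduct M k ≡ eulerProduct N k) (N*15+N≡N*16 N)
             (eulerProduct-≈[] N (N ℕ.* 15) l)))
           m≤N ⟩
    (boundedSeries 16 (N ℕ.* 16) * eulerProduct (N ℕ.* 16)) m
      ≡⟨ boundedSeries-product 16 (N ℕ.* 16) m ⟩
    multiplesProduct 16 (N ℕ.* 16) m
      ≡⟨ multiplesProduct-16 N m ⟩
    (eulerProduct N ^ 16) m ∎
    where
    open ≡-Reasoning
    N*15+N≡N*16 : ∀ N → N ℕ.* 15 ℕ.+ N ≡ N ℕ.* 16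
    N*15+N≡N*16 = ℕSolver.solve-∀

  -- From B P = P¹⁶ and Ψ P = P⁴ follows B P⁵ = P²⁰ = (Ψ P)⁵ = Ψ⁵ P⁵, and P⁵ has constant term 1.
  -- The exponent 5 is what makes 16 + 4 a multiple of 4 with quotient 5.
  parity-b₁₆ : parity ∘ b 16 ≈ parity ∘ (ψ ⊛ ψ ⟨q^ 4 ⟩)
  parity-b₁₆ N = *-cancelʳ-≈[] N B (parity ∘ (ψ ⊛ ψ ⟨q^ 4 ⟩)) {P ^ 5} P^5-constant cancelled ℕ.≤-refl
    where
    open ≡-Reasoning
    P = eulerProduct N
    B = parity ∘ b 16
    Ψ = parity ∘ ψ

    P^5-constant : (P ^ 5) 0 ≡ 1ℙ
    P^5-constant = cong (λ a → a ⊗ (a ⊗ (a ⊗ (a ⊗ (a ⊗ 1ℙ))))) (eulerProduct-constant N)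

    cancelled : B * P ^ 5 ≈[ N ] (parity ∘ (ψ ⊛ ψ ⟨q^ 4 ⟩)) * P ^ 5
    cancelled {m} m≤N = begin
      (B * P ^ 5) m
        ≡⟨ *-assoc B P (P ^ 4) m ⟨
      (B * P * P ^ 4) m
        ≡⟨ *-cong-≈[] {N} {B * P} {P ^ 16} {P ^ 4} {P ^ 4} (b₁₆*eulerProduct N) (λ _ → refl) m≤N ⟩
      (P ^ 16 * P ^ 4) m
        ≡⟨ ^-homo-* P 16 4 m ⟨
      (P ^ 20) m
        ≡⟨ ^-assocʳ P 4 5 m ⟨
      ((P ^ 4) ^ 5) m
        ≡⟨ ^-cong-≈[] {N} {Ψ * P} {P ^ 4} 5 (ψ*eulerProduct N) m≤N ⟨
      ((Ψ * P) ^ 5) m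
        ≡⟨ ^-distrib-* Ψ P 5 m ⟩
      (Ψ * Ψ ^ 4 * P ^ 5) m
        ≡⟨ *-congʳ {P ^ 5} (*-congˡ {Ψ} (parity-⟨q^4⟩ ψ)) m ⟨
      (Ψ * (parity ∘ (ψ ⟨q^ 4 ⟩)) * P ^ 5) m
        ≡⟨ *-congʳ {P ^ 5} (parity-⊛ ψ (ψ ⟨q^ 4 ⟩)) m ⟨
      ((parity ∘ (ψ ⊛ ψ ⟨q^ 4 ⟩)) * P ^ 5) m ∎

-- Divisibility of sums of two squares

open PowerSeries using (parity-b₁₆)
open import Data.Nat using (_+_; _*_; _^_)

private
  module ℕ^ = Exp ℕ.+-*-semiring
  module ℕ× = Mult ℕ.+-*-semiring
  module ℕΣ = Sum ℕ.+-*-semiring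
  module ℕBinomial = Binomial ℕ.+-*-commutativeSemiring

C-absorb : ∀ n k → suc k * (suc n C suc k) ≡ suc n * (n C k)
C-absorb n zero = begin
  1 * (suc n C 1)   ≡⟨ cong (1 *_) (nC1≡n (suc n)) ⟩
  1 * suc n         ≡⟨ ℕ.*-comm 1 (suc n) ⟩
  suc n * 1         ∎
  where open ≡-Reasoning
C-absorb zero (suc k) = ℕ.*-zeroʳ (suc (suc k))
C-absorb (suc n) (suc k) = begin
  suc (suc k) * (suc (suc n) C suc (suc k))
    ≡⟨ cong (suc (suc k) *_) (nCk+nC[k+1]≡[n+1]C[k+1] (suc n) (suc k)) ⟨
  suc (suc k) * ((suc n C suc k) + (suc n C suc (suc k)))
    ≡⟨ ℕ.*-distribˡ-+ (suc (suc k)) (suc n C suc k) _ ⟩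
  (suc n C suc k) + suc k * (suc n C suc k) + suc (suc k) * (suc n C suc (suc k))
    ≡⟨ cong₂ (λ a c → (suc n C suc k) + a + c) (C-absorb n k) (C-absorb n (suc k)) ⟩
  (suc n C suc k) + suc n * (n C k) + suc n * (n C suc k)
    ≡⟨ ℕ.+-assoc (suc n C suc k) _ _ ⟩
  (suc n C suc k) + (suc n * (n C k) + suc n * (n C suc k))
    ≡⟨ cong ((suc n C suc k) +_) (ℕ.*-distribˡ-+ (suc n) (n C k) (n C suc k)) ⟨
  (suc n C suc k) + suc n * ((n C k) + (n C suc k))
    ≡⟨ cong (λ c → (suc n C suc k) + suc n * c) (nCk+nC[k+1]≡[n+1]C[k+1] n k) ⟩
  suc (suc n) * (suc n C suc k) ∎
  where open ≡-Reasoning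

-- By the absorption identity the prime divides (k + 1) times the binomial coefficient, and it is
-- too large to divide k + 1.
prime∣C : ∀ {p} → Prime (suc p) → ∀ {k} → k < p → suc p ∣ (suc p C suc k)
prime∣C {p} pr {k} k<p with euclidsLemma (suc k) (suc p C suc k) pr
  (subst (suc p ∣_) (sym (C-absorb p k)) (m∣m*n (p C k)))
... | inj₁ p∣k = ⊥-elim (ℕ.<⇒≱ (s≤s k<p) (∣⇒≤ p∣k))
... | inj₂ p∣C = p∣C

∣-sum : ∀ {d n} (t : Vector ℕ n) → (∀ i → d ∣ t i) → d ∣ ℕΣ.sum t
∣-sum {n = zero}  t d∣t = _ ∣0
∣-sum {n = suc n} t d∣t = ∣m∣n⇒∣m+n (d∣t fzero) (∣-sum (tail t) (d∣t ∘ fsuc))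

×≡* : ∀ m n → m ℕ×.× n ≡ m * n
×≡* zero    n = refl
×≡* (suc m) n = cong (n +_) (×≡* m n)

^≡^ : ∀ m n → m ℕ^.^ n ≡ m ^ n
^≡^ m zero    = refl
^≡^ m (suc n) = cong (m *_) (^≡^ m n)

freshman : ∀ {p} → Prime p → ∀ x → ∃[ m ] suc x ^ p ≡ suc (x ^ p) + m * p
freshman {suc p} pr x = quotient p∣middle , (begin
  suc x ^ suc p
    ≡⟨ ^≡^ (suc x) (suc p) ⟨
  suc x ℕ^.^ suc p
    ≡⟨ ℕBinomial.theorem (suc p) 1 x ⟩
  t fzero + ℕΣ.sum (tail t)
    ≡⟨ cong₂ _+_ first (ℕΣ.sum-init-last (tail t)) ⟩
  x ^ suc p + (middle + last (tail t))
    ≡⟨ cong (λ a → x ^ suc p + (middle + a)) final ⟩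
  x ^ suc p + (middle + 1)
    ≡⟨ cong (x ^ suc p +_) (ℕ.+-comm middle 1) ⟩
  x ^ suc p + suc middle
    ≡⟨ ℕ.+-suc (x ^ suc p) middle ⟩
  suc (x ^ suc p) + middle
    ≡⟨ cong (suc (x ^ suc p) +_) (_∣_.equality p∣middle) ⟩
  suc (x ^ suc p) + quotient p∣middle * suc p ∎)
  where
  open ≡-Reasoning
  t = ℕBinomial.binomialTerm 1 x (suc p)
  middle = ℕΣ.sum (init (tail t))

  first : t fzero ≡ x ^ suc p
  first = begin
    1 ℕ×.× (1 * x ℕ^.^ suc p)   ≡⟨ ×≡* 1 _ ⟩
    1 * (1 * x ℕ^.^ suc p)      ≡⟨ trans (ℕ.*-identityˡ _) (ℕ.*-identityˡ _) ⟩
    x ℕ^.^ suc p                ≡⟨ ^≡^ x (suc p) ⟩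
    x ^ suc p ∎

  final : last (tail t) ≡ 1
  final rewrite Fin.toℕ-fromℕ p | nCn≡1 (suc p) | ℕ.n∸n≡0 p = begin
    1 ℕ^.^ suc p * 1 + 0  ≡⟨ trans (ℕ.+-identityʳ _) (ℕ.*-identityʳ _) ⟩
    1 ℕ^.^ suc p          ≡⟨ ^≡^ 1 (suc p) ⟩
    1 ^ suc p             ≡⟨ ℕ.^-zeroˡ (suc p) ⟩
    1                     ∎

  p∣middle : suc p ∣ middle
  p∣middle = ∣-sum (init (tail t)) λ i → subst (suc p ∣_) (sym (×≡* (suc p C toℕ (fsuc (inject₁ i))) _))
    (∣m⇒∣m*n _ (prime∣C pr (subst (_< p) (sym (Fin.toℕ-inject₁ i)) (Fin.toℕ<n i))))

-- Fermat's little theorem by induction on x. The congruence is kept as an equation with an explicit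
-- multiple of p, which in ℕ needs no subtraction.
fermat : ∀ {p} → Prime p → ∀ x → ∃[ m ] x ^ p ≡ x + m * p
fermat {suc p} pr zero    = 0 , refl
fermat {p}     pr (suc x) with m , eq ← fermat pr x | m′ , eq′ ← freshman pr x = m + m′ , (begin
  suc x ^ p                    ≡⟨ eq′ ⟩
  suc (x ^ p) + m′ * p         ≡⟨ cong (λ y → suc y + m′ * p) eq ⟩
  suc (x + m * p) + m′ * p     ≡⟨ collect x m m′ p ⟩
  suc x + (m + m′) * p         ∎)
  where
  open ≡-Reasoning
  collect : ∀ x m m′ p → suc (x + m * p) + m′ * p ≡ suc x + (m + m′) * p
  collect = ℕSolver.solve-∀

odd-powers : ∀ {d} a b j → d ∣ a + b → d ∣ a ^ (1 + 2 * j) + b ^ (1 + 2 * j)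
odd-powers {d} a b zero    d∣a+b = subst (d ∣_) (sym (cong₂ _+_ (ℕ.*-identityʳ a) (ℕ.*-identityʳ b))) d∣a+b
odd-powers {d} a b (suc j) d∣a+b rewrite ℕ.+-suc j (j + 0) = ∣m+n∣m⇒∣n
  (subst (d ∣_) eq (∣m∣n⇒∣m+n (∣n⇒∣m*n (a * a) (odd-powers a b j d∣a+b)) (∣n⇒∣m*n (B * b) d∣a+b)))
  (∣n⇒∣m*n (B * a) d∣a+b)
  where
  A = a ^ (1 + 2 * j)
  B = b ^ (1 + 2 * j)
  -- a^(m+2) + b^(m+2) = a² (a^m + b^m) + b^m (b − a) (a + b), without subtraction.
  eq : a * a * (A + B) + B * b * (a + b) ≡ B * a * (a + b) + (a * (a * A) + b * (b * B))
  eq = identity a b A B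
    where
    identity : ∀ a b A B → a * a * (A + B) + B * b * (a + b) ≡ B * a * (a + b) + (a * (a * A) + b * (b * B))
    identity = ℕSolver.solve-∀

^-square : ∀ x n → (x * x) ^ n ≡ x ^ (2 * n)
^-square x n = trans (cong (λ y → (x * y) ^ n) (sym (ℕ.*-identityʳ x))) (ℕ.^-*-assoc x 2 n)

-- For p = 4k + 3, (p - 1)/2 = 2k + 1 is odd, so x² + y² divides x^(p-1) + y^(p-1). Multiplying by x
-- y and applying Fermat turns this into 2 x y modulo p, hence p divides x or y. The factor x y
-- spares the case distinction of Fermat's theorem with exponent p - 1.
prime∣x²+y²⇒∣x : ∀ {p} → Prime p → 4 ∣ p + 1 → ∀ x y → p ∣ x * x + y * y → p ∣ x
prime∣x²+y²⇒∣x {p} pr (divides (suc k) p+1≡) x y p∣ = [ id , from-y ]′ p∣x⊎p∣y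
  where
  expand : ∀ k → suc k * 4 ≡ 1 + 2 * (1 + 2 * k) + 1
  expand = ℕSolver.solve-∀

  p≡ : p ≡ 1 + 2 * (1 + 2 * k)
  p≡ = ℕ.+-cancelʳ-≡ 1 _ _ (trans p+1≡ (expand k))

  p∤2 : p ∤ 2
  p∤2 p∣2 = ℕ.<⇒≱ (subst (2 <_) (sym p≡) (s≤s (ℕ.*-monoʳ-≤ 2 (s≤s (z≤n {2 * k}))))) (∣⇒≤ p∣2)

  from-y : p ∣ y → p ∣ x
  from-y p∣y = [ id , id ]′ (euclidsLemma x x pr
    (∣m+n∣m⇒∣n (subst (p ∣_) (ℕ.+-comm (x * x) (y * y)) p∣) (∣m⇒∣m*n y p∣y)))

  p∣powers : p ∣ x ^ (2 * (1 + 2 * k)) + y ^ (2 * (1 + 2 * k))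
  p∣powers = subst (p ∣_) (cong₂ _+_ (^-square x (1 + 2 * k)) (^-square y (1 + 2 * k)))
    (odd-powers (x * x) (y * y) k p∣)

  p∣2xy : p ∣ 2 * (x * y)
  p∣2xy with m , eqx ← fermat pr x | m′ , eqy ← fermat pr y =
    ∣m+n∣m⇒∣n (subst (p ∣_) eq (∣n⇒∣m*n (x * y) p∣powers)) (n∣m*n (m * y + m′ * x))
    where
    open ≡-Reasoning
    eq : x * y * (x ^ (2 * (1 + 2 * k)) + y ^ (2 * (1 + 2 * k))) ≡ (m * y + m′ * x) * p + 2 * (x * y)
    eq = begin
      x * y * (x ^ (2 * (1 + 2 * k)) + y ^ (2 * (1 + 2 * k)))
        ≡⟨ regroup x y (x ^ (2 * (1 + 2 * k))) (y ^ (2 * (1 + 2 * k))) ⟩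
      x ^ (1 + 2 * (1 + 2 * k)) * y + y ^ (1 + 2 * (1 + 2 * k)) * x
        ≡⟨ cong₂ (λ a b → a * y + b * x) (trans (cong (x ^_) (sym p≡)) eqx) (trans (cong (y ^_) (sym p≡)) eqy) ⟩
      (x + m * p) * y + (y + m′ * p) * x
        ≡⟨ collect x y m m′ p ⟩
      (m * y + m′ * x) * p + 2 * (x * y) ∎
      where
      regroup : ∀ x y a b → x * y * (a + b) ≡ x * a * y + y * b * x
      regroup = ℕSolver.solve-∀
      collect : ∀ x y m m′ p → (x + m * p) * y + (y + m′ * p) * x ≡ (m * y + m′ * x) * p + 2 * (x * y)
      collect = ℕSolver.solve-∀

  p∣x⊎p∣y : p ∣ x ⊎ p ∣ y
  p∣x⊎p∣y = [ ⊥-elim ∘ p∤2 , euclidsLemma x y pr ]′ (euclidsLemma 2 (x * y) pr p∣2xy)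
prime∣x²+y²⇒∣x {p} pr (divides zero p+1≡) x y p∣ = ⊥-elim (ℕ.1+n≢0 (trans (ℕ.+-comm 1 p) p+1≡))

-- Representations by triangular numbers

-- A cofactor of an odd number is odd, so c = 2j + 1, and 2k + 1 = (2j + 1)(2h + 1) is solved for k.
odd-factor : ∀ h k c → k + k + 1 ≡ c * (h + h + 1) → ∃[ j ] k ≡ (h + h + 1) * j + h
odd-factor h k c eq with halves c
... | odd j  = j , ℕ.*-cancelˡ-≡ k _ 2 (ℕ.+-cancelʳ-≡ 1 _ _ (trans (double k) (trans eq (expand h j))))
  where
  double : ∀ k → 2 * k + 1 ≡ k + k + 1
  double = ℕSolver.solve-∀
  expand : ∀ h j → suc (j + j) * (h + h + 1) ≡ 2 * ((h + h + 1) * j + h) + 1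
  expand = ℕSolver.solve-∀
... | even j = ⊥-elim (1≢0 (trans (sym (parity-odd k)) (trans (cong parity eq) (parity-even j (h + h + 1)))))
  where
  1≢0 : 1ℙ ≢ 0ℙ
  1≢0 ()
  parity-odd : ∀ k → parity (k + k + 1) ≡ 1ℙ
  parity-odd k rewrite ℙ.+-homo-+ (k + k) 1 | ℙ.+-homo-+ k k | ℙ.p+p≡0ℙ (parity k) = refl
  parity-even : ∀ j m → parity ((j + j) * m) ≡ 0ℙ
  parity-even j m rewrite ℙ.*-homo-* (j + j) m | ℙ.+-homo-+ j j | ℙ.p+p≡0ℙ (parity j) = refl

8*-injective : ∀ {m n} → 8 * m + 1 ≡ 8 * n + 1 → m ≡ n
8*-injective {m} {n} eq = ℕ.*-cancelˡ-≡ m n 8 (ℕ.+-cancelʳ-≡ 1 _ _ eq)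

-- The index k = p j + h is the one with 2k + 1 = p (2j + 1). Multiplying 8 T j + 1 by p² therefore
-- sends T j to p² T j + (p² - 1)/8, and (p² - 1)/8 is `T h`.
T-scale : ∀ h j → T ((h + h + 1) * j + h) ≡ (h + h + 1) * (h + h + 1) * T j + T h
T-scale h j = 8*-injective (begin
  8 * T (p * j + h) + 1
    ≡⟨ 8*T+1≡[2k+1]² (p * j + h) ⟩
  (p * j + h + (p * j + h) + 1) * (p * j + h + (p * j + h) + 1)
    ≡⟨ factor h j ⟩
  p * p * ((j + j + 1) * (j + j + 1))
    ≡⟨ cong (p * p *_) (8*T+1≡[2k+1]² j) ⟨
  p * p * (8 * T j + 1)
    ≡⟨ split (p * p) (T j) ⟩
  8 * (p * p * T j) + p * p
    ≡⟨ cong (8 * (p * p * T j) +_) (8*T+1≡[2k+1]² h) ⟨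
  8 * (p * p * T j) + (8 * T h + 1)
    ≡⟨ gather (p * p * T j) (T h) ⟩
  8 * (p * p * T j + T h) + 1 ∎)
  where
  open ≡-Reasoning
  p = h + h + 1
  factor : ∀ h j →
    ((h + h + 1) * j + h + ((h + h + 1) * j + h) + 1) * ((h + h + 1) * j + h + ((h + h + 1) * j + h) + 1)
    ≡ (h + h + 1) * (h + h + 1) * ((j + j + 1) * (j + j + 1))
  factor = ℕSolver.solve-∀
  split : ∀ c t → c * (8 * t + 1) ≡ 8 * (c * t) + c
  split = ℕSolver.solve-∀
  gather : ∀ a t → 8 * a + (8 * t + 1) ≡ 8 * (a + t) + 1
  gather = ℕSolver.solve-∀

prime∣odd⇒T : ∀ h → Prime (h + h + 1) → ∀ k → (h + h + 1) ∣ (k + k + 1) →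
  ∃[ j ] k ≡ (h + h + 1) * j + h × T k ≡ (h + h + 1) * (h + h + 1) * T j + T h
prime∣odd⇒T h pr k (divides c eq) with j , refl ← odd-factor h k c eq = j , refl , T-scale h j

-- The hypothesis makes (2k + 1)² equal to p² (8 i + 1), so p divides 2k + 1.
T-unscale : ∀ h → Prime (h + h + 1) → ∀ i k → T k ≡ (h + h + 1) * (h + h + 1) * i + T h →
  ∃[ j ] k ≡ (h + h + 1) * j + h × T j ≡ i
T-unscale h pr i k eq = unscaled (prime∣odd⇒T h pr k p∣2k+1)
  where
  open ≡-Reasoning
  p = h + h + 1

  regroup : ∀ a t → 8 * (a + t) + 1 ≡ 8 * a + (8 * t + 1)
  regroup = ℕSolver.solve-∀
  factor : ∀ p i → 8 * (p * p * i) + p * p ≡ p * (p * (8 * i + 1))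
  factor = ℕSolver.solve-∀

  square : (k + k + 1) * (k + k + 1) ≡ p * (p * (8 * i + 1))
  square = begin
    (k + k + 1) * (k + k + 1)       ≡⟨ 8*T+1≡[2k+1]² k ⟨
    8 * T k + 1                     ≡⟨ cong (λ t → 8 * t + 1) eq ⟩
    8 * (p * p * i + T h) + 1       ≡⟨ regroup (p * p * i) (T h) ⟩
    8 * (p * p * i) + (8 * T h + 1) ≡⟨ cong (8 * (p * p * i) +_) (8*T+1≡[2k+1]² h) ⟩
    8 * (p * p * i) + p * p         ≡⟨ factor p i ⟩
    p * (p * (8 * i + 1))           ∎

  p∣2k+1 : p ∣ (k + k + 1)
  p∣2k+1 = [ id , id ]′ (euclidsLemma (k + k + 1) (k + k + 1) pr (subst (p ∣_) (sym square) (m∣m*n _)))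

  unscaled : ∃[ j ] k ≡ p * j + h × T k ≡ p * p * T j + T h → ∃[ j ] k ≡ p * j + h × T j ≡ i
  unscaled (j , k≡ , Tk≡) = j , k≡ ,
    ℕ.*-cancelˡ-≡ (T j) i (p * p) {{ℕ.m*n≢0 p p {{prime⇒nonZero pr}} {{prime⇒nonZero pr}}}}
      (ℕ.+-cancelʳ-≡ (T h) _ _ (trans (sym Tk≡) eq))

triangularRoots : ℕ → List ℕ
triangularRoots m = filter (λ k → T k ≟ m) (upTo (suc m))

triangularRoots-unique : ∀ m → Unique (triangularRoots m)
triangularRoots-unique m = Unique.filter⁺ (λ k → T k ≟ m) (Unique.upTo⁺ (suc m))

∈-triangularRoots⁺ : ∀ {k m} → T k ≡ m → k ∈ triangularRoots m
∈-triangularRoots⁺ {k} refl = ∈-filter⁺ (λ j → T j ≟ T k) (∈-upTo⁺ (s≤s (k≤T k))) refl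

∈-triangularRoots⁻ : ∀ {k} m → k ∈ triangularRoots m → T k ≡ m
∈-triangularRoots⁻ m p = proj₂ (∈-filter⁻ (λ j → T j ≟ m) {xs = upTo (suc m)} p)

triangularRoots-scale : ∀ h → Prime (h + h + 1) → ∀ i →
  triangularRoots ((h + h + 1) * (h + h + 1) * i + T h) ↭ map (λ j → (h + h + 1) * j + h) (triangularRoots i)
triangularRoots-scale h pr i = unique∧set⇒↭ (triangularRoots-unique m)
    (Unique.map⁺ {f = f} injective (triangularRoots-unique i)) (mk⇔ to from)
  where
  p = h + h + 1
  m = p * p * i + T h

  f : ℕ → ℕ
  f j = p * j + h

  injective : ∀ {j k} → f j ≡ f k → j ≡ k
  injective {j} {k} eq = ℕ.*-cancelˡ-≡ j k p {{prime⇒nonZero pr}} (ℕ.+-cancelʳ-≡ h (p * j) (p * k) eq)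

  unscaled : ∀ {k} → ∃[ j ] k ≡ f j × T j ≡ i → k ∈ map f (triangularRoots i)
  unscaled (j , refl , Tj≡i) = ∈-map⁺ f (∈-triangularRoots⁺ Tj≡i)

  to : ∀ {k} → k ∈ triangularRoots m → k ∈ map f (triangularRoots i)
  to {k} k∈ = unscaled (T-unscale h pr i k (∈-triangularRoots⁻ m k∈))

  scaled : ∀ {k} → ∃[ j ] j ∈ triangularRoots i × k ≡ f j → k ∈ triangularRoots m
  scaled (j , j∈ , refl) = ∈-triangularRoots⁺
    (trans (T-scale h j) (cong (λ t → p * p * t + T h) (∈-triangularRoots⁻ i j∈)))

  from : ∀ {k} → k ∈ map f (triangularRoots i) → k ∈ triangularRoots m
  from k∈ = scaled (∈-map⁻ f k∈)

ψ-scale : ∀ h → Prime (h + h + 1) → ∀ i → ψ ((h + h + 1) * (h + h + 1) * i + T h) ≡ ψ i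
ψ-scale h pr i = trans
  (↭-length (triangularRoots-scale h pr i))
  (length-map (λ j → (h + h + 1) * j + h) (triangularRoots i))

length≢0⇒∈ : ∀ {A : Set} (xs : List A) → length xs ≢ 0 → ∃[ x ] x ∈ xs
length≢0⇒∈ []      ≢0 = ⊥-elim (≢0 refl)
length≢0⇒∈ (x ∷ _) _  = x , here refl

ψ≢0⇒T : ∀ m → ψ m ≢ 0 → ∃[ k ] T k ≡ m
ψ≢0⇒T m ψ≢0 = Product.map₂ (∈-triangularRoots⁻ m) (length≢0⇒∈ (triangularRoots m) ψ≢0)

ψ[q^4]≢0⇒T : ∀ m → (ψ ⟨q^ 4 ⟩) m ≢ 0 → ∃[ k ] m ≡ T k * 4
ψ[q^4]≢0⇒T m ≢0 with 4 ∣? m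
... | no 4∤m = ⊥-elim (≢0 (⟨q^⟩-nonmultiple ψ 4 4∤m))
... | yes (divides-refl i)
    with k , Tk≡i ← ψ≢0⇒T i (≢0 ∘ trans (⟨q^⟩-multiple ψ 4 i)) = k , cong (_* 4) (sym Tk≡i)

-- Since p² = 8 `T h` + 1, the scaled index is congruent to i modulo 4. Multiples of 4 thus
-- correspond to multiples of 4, where the claim is `ψ-scale`; elsewhere both coefficients are zero.
ψ[q^4]-scale : ∀ h → Prime (h + h + 1) → ∀ i →
  (ψ ⟨q^ 4 ⟩) ((h + h + 1) * (h + h + 1) * i + T h * 4) ≡ (ψ ⟨q^ 4 ⟩) i
ψ[q^4]-scale h pr i with 4 ∣? i
... | yes (divides-refl e) = begin
  (ψ ⟨q^ 4 ⟩) (p * p * (e * 4) + T h * 4)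
    ≡⟨ cong (ψ ⟨q^ 4 ⟩) (regroup (p * p) e (T h)) ⟩
  (ψ ⟨q^ 4 ⟩) ((p * p * e + T h) * 4)
    ≡⟨ ⟨q^⟩-multiple ψ 4 (p * p * e + T h) ⟩
  ψ (p * p * e + T h)
    ≡⟨ ψ-scale h pr e ⟩
  ψ e
    ≡⟨ ⟨q^⟩-multiple ψ 4 e ⟨
  (ψ ⟨q^ 4 ⟩) (e * 4) ∎
  where
  open ≡-Reasoning
  p = h + h + 1
  regroup : ∀ c e t → c * (e * 4) + t * 4 ≡ (c * e + t) * 4
  regroup = ℕSolver.solve-∀
... | no 4∤i = trans (⟨q^⟩-nonmultiple ψ 4 4∤) (sym (⟨q^⟩-nonmultiple ψ 4 4∤i))
  where
  p = h + h + 1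
  4∤ : 4 ∤ p * p * i + T h * 4
  4∤ 4∣ = 4∤i (∣m+n∣m⇒∣n (subst (4 ∣_) eq 4∣) (n∣m*n (2 * T h * i + T h)))
    where
    regroup : ∀ t i → (8 * t + 1) * i + t * 4 ≡ (2 * t * i + t) * 4 + i
    regroup = ℕSolver.solve-∀
    eq : p * p * i + T h * 4 ≡ (2 * T h * i + T h) * 4 + i
    eq = trans (cong (λ c → c * i + T h * 4) (sym (8*T+1≡[2k+1]² h))) (regroup (T h) i)

-- Finite sums determined by their nonzero terms

_≢0? : ∀ (g : ℕ → ℕ) x → Dec (g x ≢ 0)
(g ≢0?) x = ¬? (g x ≟ 0)

sum-filter-≢0 : ∀ (g : ℕ → ℕ) xs → sum (map g (filter (g ≢0?) xs)) ≡ sum (map g xs)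
sum-filter-≢0 g []       = refl
sum-filter-≢0 g (x ∷ xs) = [ zero-term , nonzero-term ]′ (toSum (g x ≟ 0))
  where
  zero-term : g x ≡ 0 → sum (map g (filter (g ≢0?) (x ∷ xs))) ≡ sum (map g (x ∷ xs))
  zero-term gx≡0 = trans (cong (sum ∘ map g) (filter-reject (g ≢0?) (λ gx≢0 → gx≢0 gx≡0)))
    (trans (sum-filter-≢0 g xs) (cong (_+ sum (map g xs)) (sym gx≡0)))

  nonzero-term : g x ≢ 0 → sum (map g (filter (g ≢0?) (x ∷ xs))) ≡ sum (map g (x ∷ xs))
  nonzero-term gx≢0 = trans (cong (sum ∘ map g) (filter-accept (g ≢0?) gx≢0))
    (cong (g x +_) (sum-filter-≢0 g xs))

-- Allows a convolution to be reindexed, or shown to vanish, by locating its nonzero terms only.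
sum-support : ∀ (g : ℕ → ℕ) {xs ys} → Unique xs → Unique ys →
  (∀ {x} → g x ≢ 0 → x ∈ xs → x ∈ ys) → (∀ {x} → g x ≢ 0 → x ∈ ys → x ∈ xs) →
  sum (map g xs) ≡ sum (map g ys)
sum-support g {xs} {ys} u v to from = begin
  sum (map g xs)                    ≡⟨ sum-filter-≢0 g xs ⟨
  sum (map g (filter (g ≢0?) xs))   ≡⟨ sum-↭ (↭-map⁺ g (unique∧set⇒↭ (Unique.filter⁺ (g ≢0?) u)
                                         (Unique.filter⁺ (g ≢0?) v)
                                         (mk⇔ (restrict to) (restrict from)))) ⟩
  sum (map g (filter (g ≢0?) ys))   ≡⟨ sum-filter-≢0 g ys ⟩
  sum (map g ys)                    ∎
  where
  open ≡-Reasoning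
  restrict : ∀ {xs ys x} → (∀ {x} → g x ≢ 0 → x ∈ xs → x ∈ ys) → x ∈ filter (g ≢0?) xs → x ∈ filter (g ≢0?) ys
  restrict {xs} ⊆ x∈ = let x∈xs , gx≢0 = ∈-filter⁻ (g ≢0?) {xs = xs} x∈ in ∈-filter⁺ (g ≢0?) (⊆ gx≢0 x∈xs) gx≢0

-- Coefficients of ψ(q) ψ(q⁴) and divisibility of 8m + 5 by p

ψψ₄-term : ℕ → ℕ → ℕ
ψψ₄-term m i = ψ i * (ψ ⟨q^ 4 ⟩) (m ∸ i)

ψψ₄-term≢0 : ∀ {m i} → i ≤ m → ψψ₄-term m i ≢ 0 → ∃₂ λ j k → i ≡ T j × m ≡ T j + T k * 4
ψψ₄-term≢0 {m} {i} i≤m ≢0 = combine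
  (ψ≢0⇒T i (λ ψ≡0 → ≢0 (cong (_* (ψ ⟨q^ 4 ⟩) (m ∸ i)) ψ≡0)))
  (ψ[q^4]≢0⇒T (m ∸ i) (λ ψ≡0 → ≢0 (trans (cong (ψ i *_) ψ≡0) (ℕ.*-zeroʳ (ψ i)))))
  where
  combine : ∃[ j ] T j ≡ i → ∃[ k ] m ∸ i ≡ T k * 4 → ∃₂ λ j k → i ≡ T j × m ≡ T j + T k * 4
  combine (j , Tj≡i) (k , eq) = j , k , sym Tj≡i , trans (sym (ℕ.m+[n∸m]≡n i≤m)) (cong₂ _+_ (sym Tj≡i) eq)

-- The constant 5 is 1 + 4: one unit completes the square for j, and four units complete it for k.
sum-of-squares : ∀ j k → 8 * (T j + T k * 4) + 5 ≡ (j + j + 1) * (j + j + 1) + 2 * (k + k + 1) * (2 * (k + k + 1))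
sum-of-squares j k = begin
  8 * (T j + T k * 4) + 5
    ≡⟨ regroup (T j) (T k) ⟩
  8 * T j + 1 + 4 * (8 * T k + 1)
    ≡⟨ cong₂ (λ a c → a + 4 * c) (8*T+1≡[2k+1]² j) (8*T+1≡[2k+1]² k) ⟩
  (j + j + 1) * (j + j + 1) + 4 * ((k + k + 1) * (k + k + 1))
    ≡⟨ cong ((j + j + 1) * (j + j + 1) +_) (four (k + k + 1)) ⟩
  (j + j + 1) * (j + j + 1) + 2 * (k + k + 1) * (2 * (k + k + 1)) ∎
  where
  open ≡-Reasoning
  regroup : ∀ s t → 8 * (s + t * 4) + 5 ≡ 8 * s + 1 + 4 * (8 * t + 1)
  regroup = ℕSolver.solve-∀
  four : ∀ x → 4 * (x * x) ≡ 2 * x * (2 * x)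
  four = ℕSolver.solve-∀

module _ (h : ℕ) (pr : Prime (h + h + 1)) (4∣p+1 : 4 ∣ h + h + 1 + 1) where

  private
    p s : ℕ
    p = h + h + 1
    s = T h

    p*p≡ : p * p ≡ 8 * s + 1
    p*p≡ = sym (8*T+1≡[2k+1]² h)

  -- A nonzero term represents 8m + 5 as x² + y², and p divides both x and y. The first conclusion
  -- serves the vanishing statement; the second, from p ∣ x alone, locates the term for the descent.
  ψψ₄-term≢0⇒∣ : ∀ {m i} → i ≤ m → ψψ₄-term m i ≢ 0 → p ∣ 8 * m + 5 →
    p * p ∣ 8 * m + 5 × ∃[ j ] i ≡ p * p * T j + s
  ψψ₄-term≢0⇒∣ {m} {i} i≤m ≢0 p∣ = from-roots (ψψ₄-term≢0 i≤m ≢0)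
    where
    from-roots : (∃₂ λ j k → i ≡ T j × m ≡ T j + T k * 4) → p * p ∣ 8 * m + 5 × ∃[ j ] i ≡ p * p * T j + s
    from-roots (j , k , i≡ , m≡) =
      subst (p * p ∣_) (sym 8m+5≡) (∣m∣n⇒∣m+n (*-pres-∣ p∣x p∣x) (*-pres-∣ p∣y p∣y)) ,
      Product.map₂ (λ eq → trans i≡ (proj₂ eq)) (prime∣odd⇒T h pr j p∣x)
      where
      x = j + j + 1
      y = 2 * (k + k + 1)
      8m+5≡ : 8 * m + 5 ≡ x * x + y * y
      8m+5≡ = trans (cong (λ m → 8 * m + 5) m≡) (sum-of-squares j k)
      p∣x : p ∣ x
      p∣x = prime∣x²+y²⇒∣x pr 4∣p+1 x y (subst (p ∣_) 8m+5≡ p∣)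
      p∣y : p ∣ y
      p∣y = prime∣x²+y²⇒∣x pr 4∣p+1 y x (subst (p ∣_) (trans 8m+5≡ (ℕ.+-comm (x * x) (y * y))) p∣)

  -- The shift is chosen so that 8m + 5 = p² (8n + 5). Nonzero terms then occur only at indices φ i;
  -- there the complementary index is p² (n - i) + 4s, so both factors scale back to those of the
  -- term i at n.
  ψψ₄-descent : ∀ n → (ψ ⊛ ψ ⟨q^ 4 ⟩) (p * p * n + 5 * s) ≡ (ψ ⊛ ψ ⟨q^ 4 ⟩) n
  ψψ₄-descent n = begin
    sum (map (ψψ₄-term m) (upTo (suc m)))
      ≡⟨ sum-support (ψψ₄-term m) (Unique.upTo⁺ (suc m))
           (Unique.map⁺ {f = φ} φ-injective (Unique.upTo⁺ (suc n))) to from ⟩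
    sum (map (ψψ₄-term m) (map φ (upTo (suc n))))
      ≡⟨ cong sum (map-∘ (upTo (suc n))) ⟨
    sum (map (ψψ₄-term m ∘ φ) (upTo (suc n)))
      ≡⟨ cong sum (map-cong-local (All.map (term-φ ∘ ℕ.s≤s⁻¹) (all-upTo (suc n)))) ⟩
    sum (map (ψψ₄-term n) (upTo (suc n))) ∎
    where
    open ≡-Reasoning
    m = p * p * n + 5 * s

    φ : ℕ → ℕ
    φ i = p * p * i + s

    instance
      p*p≢0 : ℕ.NonZero (p * p)
      p*p≢0 = ℕ.m*n≢0 p p {{prime⇒nonZero pr}} {{prime⇒nonZero pr}}

    φ-injective : ∀ {i j} → φ i ≡ φ j → i ≡ j
    φ-injective {i} {j} eq = ℕ.*-cancelˡ-≡ i j (p * p) (ℕ.+-cancelʳ-≡ s (p * p * i) (p * p * j) eq)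

    p∣8m+5 : p ∣ 8 * m + 5
    p∣8m+5 = subst (p ∣_) (sym (begin
      8 * (p * p * n + 5 * s) + 5     ≡⟨ regroup (p * p * n) s ⟩
      8 * (p * p * n) + 5 * (8 * s + 1) ≡⟨ cong (λ q → 8 * (p * p * n) + 5 * q) p*p≡ ⟨
      8 * (p * p * n) + 5 * (p * p)   ≡⟨ factor p n ⟩
      p * (p * (8 * n + 5))           ∎)) (m∣m*n (p * (8 * n + 5)))
      where
      regroup : ∀ a s → 8 * (a + 5 * s) + 5 ≡ 8 * a + 5 * (8 * s + 1)
      regroup = ℕSolver.solve-∀
      factor : ∀ p n → 8 * (p * p * n) + 5 * (p * p) ≡ p * (p * (8 * n + 5))
      factor = ℕSolver.solve-∀

    m≡φ+ : ∀ {i} → i ≤ n → m ≡ φ i + (p * p * (n ∸ i) + s * 4)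
    m≡φ+ {i} i≤n = trans (cong (λ n → p * p * n + 5 * s) (sym (ℕ.m+[n∸m]≡n i≤n))) (regroup (p * p) i (n ∸ i) s)
      where
      regroup : ∀ c i o s → c * (i + o) + 5 * s ≡ c * i + s + (c * o + s * 4)
      regroup = ℕSolver.solve-∀

    -- The gap is p² - 4s = 4s + 1. It ensures that the indices φ i within range are those with i ≤
    -- n.
    m<φ[1+n] : m < φ (suc n)
    m<φ[1+n] = subst (m <_) (sym (begin
      p * p * suc n + s               ≡⟨ expand (p * p) n s ⟩
      p * p * n + s + p * p           ≡⟨ cong (p * p * n + s +_) p*p≡ ⟩
      p * p * n + s + (8 * s + 1)     ≡⟨ regroup (p * p * n) s ⟩
      p * p * n + 5 * s + suc (4 * s) ∎)) (ℕ.m<m+n m (s≤s z≤n))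
      where
      expand : ∀ c n s → c * suc n + s ≡ c * n + s + c
      expand = ℕSolver.solve-∀
      regroup : ∀ a s → a + s + (8 * s + 1) ≡ a + 5 * s + suc (4 * s)
      regroup = ℕSolver.solve-∀

    φ≤m⇒≤n : ∀ i → φ i ≤ m → i ≤ n
    φ≤m⇒≤n i φi≤m = ℕ.s≤s⁻¹ (ℕ.*-cancelˡ-< (p * p) i (suc n)
      (ℕ.+-cancelʳ-< s (p * p * i) (p * p * suc n) (ℕ.≤-<-trans φi≤m m<φ[1+n])))

    to : ∀ {i} → ψψ₄-term m i ≢ 0 → i ∈ upTo (suc m) → i ∈ map φ (upTo (suc n))
    to {i} ≢0 i∈ = from-root (proj₂ (ψψ₄-term≢0⇒∣ i≤m ≢0 p∣8m+5))
      where
      i≤m = ℕ.s≤s⁻¹ (∈-upTo⁻ i∈)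
      from-root : ∃[ j ] i ≡ φ (T j) → i ∈ map φ (upTo (suc n))
      from-root (j , i≡) = subst (_∈ map φ (upTo (suc n))) (sym i≡)
        (∈-map⁺ φ (∈-upTo⁺ (s≤s (φ≤m⇒≤n (T j) (subst (_≤ m) i≡ i≤m)))))

    from : ∀ {i} → ψψ₄-term m i ≢ 0 → i ∈ map φ (upTo (suc n)) → i ∈ upTo (suc m)
    from {i} _ i∈ = in-range (∈-map⁻ φ i∈)
      where
      in-range : ∃[ j ] j ∈ upTo (suc n) × i ≡ φ j → i ∈ upTo (suc m)
      in-range (j , j∈ , i≡) = ∈-upTo⁺ (s≤s (subst₂ _≤_
        (sym i≡) (sym (m≡φ+ (ℕ.s≤s⁻¹ (∈-upTo⁻ j∈)))) (ℕ.m≤m+n (φ j) (p * p * (n ∸ j) + s * 4))))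

    term-φ : ∀ {i} → i ≤ n → ψψ₄-term m (φ i) ≡ ψψ₄-term n i
    term-φ {i} i≤n = cong₂ _*_ (ψ-scale h pr i)
      (trans (cong (ψ ⟨q^ 4 ⟩) (trans (cong (_∸ φ i) (m≡φ+ i≤n))
                                     (ℕ.m+n∸m≡n (φ i) (p * p * (n ∸ i) + s * 4))))
             (ψ[q^4]-scale h pr (n ∸ i)))

  ψψ₄-vanishes : ∀ m → p ∣ 8 * m + 5 → p * p ∤ 8 * m + 5 → (ψ ⊛ ψ ⟨q^ 4 ⟩) m ≡ 0
  ψψ₄-vanishes m p∣ p²∤ = sum-support (ψψ₄-term m) (Unique.upTo⁺ (suc m)) AllPairs.[]
    (λ ≢0 i∈ → ⊥-elim (p²∤ (proj₁ (ψψ₄-term≢0⇒∣ (ℕ.s≤s⁻¹ (∈-upTo⁻ i∈)) ≢0 p∣)))) (λ _ ())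

-- Parity of b₁₆ along the progressions

fromParity : Parity → ℕ
fromParity 0ℙ = 0
fromParity 1ℙ = 1

%2≡fromParity : ∀ n → n % 2 ≡ fromParity (parity n)
%2≡fromParity zero          = refl
%2≡fromParity (suc zero)    = refl
%2≡fromParity (suc (suc n)) = %2≡fromParity n

parity≡⇒≡[mod2] : ∀ m n → parity m ≡ parity n → m ≡ n [mod 2 ]
parity≡⇒≡[mod2] m n eq = trans (%2≡fromParity m) (trans (cong fromParity eq) (sym (%2≡fromParity n)))

[5q∸5]/8 : ∀ {q u} → q ≡ 8 * u + 1 → (5 * q ∸ 5) / 8 ≡ 5 * u
[5q∸5]/8 {q} {u} q≡ = begin
  (5 * q ∸ 5) / 8             ≡⟨ cong (λ q → (5 * q ∸ 5) / 8) q≡ ⟩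
  (5 * (8 * u + 1) ∸ 5) / 8   ≡⟨ cong (λ a → (a ∸ 5) / 8) (expand u) ⟩
  (5 * u * 8 + 5 ∸ 5) / 8     ≡⟨ cong (_/ 8) (ℕ.m+n∸n≡m (5 * u * 8) 5) ⟩
  5 * u * 8 / 8               ≡⟨ ℕ.m*n/n≡m (5 * u) 8 ⟩
  5 * u                       ∎
  where
  open ≡-Reasoning
  expand : ∀ u → 5 * (8 * u + 1) ≡ 5 * u * 8 + 5
  expand = ℕSolver.solve-∀

module _ (h : ℕ) (pr : Prime (h + h + 1)) (4∣p+1 : 4 ∣ h + h + 1 + 1) where

  private
    p s : ℕ
    p = h + h + 1
    s = T h

    p*p≡ : p * p ≡ 8 * s + 1
    p*p≡ = sym (8*T+1≡[2k+1]² h)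

    -- The number (p^(2α) - 1)/8 without division; the recursion expands (8s + 1)(8 `e α` + 1). Five
    -- times it is the offset in the theorem.
    e : ℕ → ℕ
    e zero    = 0
    e (suc α) = s * (8 * e α + 1) + e α

    p^[2+2α] : ∀ α → p ^ (2 * suc α) ≡ p * p * p ^ (2 * α)
    p^[2+2α] α = trans (cong (p ^_) (ℕ.*-suc 2 α)) (sym (ℕ.*-assoc p p (p ^ (2 * α))))

    p^2α≡ : ∀ α → p ^ (2 * α) ≡ 8 * e α + 1
    p^2α≡ zero    = refl
    p^2α≡ (suc α) = begin
      p ^ (2 * suc α)                         ≡⟨ p^[2+2α] α ⟩
      p * p * p ^ (2 * α)                     ≡⟨ cong₂ _*_ p*p≡ (p^2α≡ α) ⟩
      (8 * s + 1) * (8 * e α + 1)             ≡⟨ expand s (e α) ⟩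
      8 * (s * (8 * e α + 1) + e α) + 1       ∎
      where
      open ≡-Reasoning
      expand : ∀ s u → (8 * s + 1) * (8 * u + 1) ≡ 8 * (s * (8 * u + 1) + u) + 1
      expand = ℕSolver.solve-∀

  -- Induction on α with n free: the index at level α + 1 for n is the index at level α for p² n +
  -- 5s, and `ψψ₄-descent` returns from there to n.
  b₁₆-progression : ∀ α n → parity (b 16 (p ^ (2 * α) * n + 5 * e α)) ≡ parity ((ψ ⊛ ψ ⟨q^ 4 ⟩) n)
  b₁₆-progression zero    n = trans
    (cong (parity ∘ b 16) (trans (ℕ.+-identityʳ (1 * n)) (ℕ.*-identityˡ n)))
    (parity-b₁₆ n)
  b₁₆-progression (suc α) n = begin
    parity (b 16 (p ^ (2 * suc α) * n + 5 * e (suc α)))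
      ≡⟨ cong (parity ∘ b 16) index ⟩
    parity (b 16 (p ^ (2 * α) * (p * p * n + 5 * s) + 5 * e α))
      ≡⟨ b₁₆-progression α (p * p * n + 5 * s) ⟩
    parity ((ψ ⊛ ψ ⟨q^ 4 ⟩) (p * p * n + 5 * s))
      ≡⟨ cong parity (ψψ₄-descent h pr 4∣p+1 n) ⟩
    parity ((ψ ⊛ ψ ⟨q^ 4 ⟩) n) ∎
    where
    open ≡-Reasoning
    regroup : ∀ c Q n s u → c * Q * n + 5 * (s * Q + u) ≡ Q * (c * n + 5 * s) + 5 * u
    regroup = ℕSolver.solve-∀
    index : p ^ (2 * suc α) * n + 5 * e (suc α) ≡ p ^ (2 * α) * (p * p * n + 5 * s) + 5 * e α
    index = trans
      (cong₂ (λ a q → a * n + 5 * (s * q + e α)) (p^[2+2α] α) (sym (p^2α≡ α)))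
      (regroup (p * p) (p ^ (2 * α)) n s (e α))

  b₁₆-series : ∀ α → (λ n → b 16 (p ^ (2 * α) * n + (5 * p ^ (2 * α) ∸ 5) / 8)) ≋ ψ ⊛ (ψ ⟨q^ 4 ⟩) [mod 2 ]
  b₁₆-series α n = parity≡⇒≡[mod2] (b 16 (p ^ (2 * α) * n + (5 * p ^ (2 * α) ∸ 5) / 8)) ((ψ ⊛ ψ ⟨q^ 4 ⟩) n)
    (trans (cong (λ a → parity (b 16 (p ^ (2 * α) * n + a))) ([5q∸5]/8 {u = e α} (p^2α≡ α)))
           (b₁₆-progression α n))

  -- Here 8m + 5 is p (p (8n + 5) + 8i), and p does not divide 8i. So p divides 8m + 5 exactly once.
  ψψ₄-vanishes-progression : ∀ n i → 1 ≤ i → i < p → (ψ ⊛ ψ ⟨q^ 4 ⟩) (p * p * n + p * i + 5 * s) ≡ 0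
  ψψ₄-vanishes-progression n i 1≤i i<p = ψψ₄-vanishes h pr 4∣p+1 (p * p * n + p * i + 5 * s)
    (subst (p ∣_) (sym 8m+5≡) (m∣m*n w))
    (λ p²∣ → p∤w (*-cancelˡ-∣ p {{prime⇒nonZero pr}} (subst (p * p ∣_) 8m+5≡ p²∣)))
    where
    open ≡-Reasoning
    w = p * (8 * n + 5) + 8 * i

    8m+5≡ : 8 * (p * p * n + p * i + 5 * s) + 5 ≡ p * w
    8m+5≡ = begin
      8 * (p * p * n + p * i + 5 * s) + 5            ≡⟨ regroup (p * p * n) (p * i) s ⟩
      8 * (p * p * n) + 8 * (p * i) + 5 * (8 * s + 1) ≡⟨ cong (λ c → 8 * (p * p * n) + 8 * (p * i) + 5 * c) p*p≡ ⟨
      8 * (p * p * n) + 8 * (p * i) + 5 * (p * p)    ≡⟨ factor p n i ⟩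
      p * (p * (8 * n + 5) + 8 * i)                  ∎
      where
      regroup : ∀ a c s → 8 * (a + c + 5 * s) + 5 ≡ 8 * a + 8 * c + 5 * (8 * s + 1)
      regroup = ℕSolver.solve-∀
      factor : ∀ p n i → 8 * (p * p * n) + 8 * (p * i) + 5 * (p * p) ≡ p * (p * (8 * n + 5) + 8 * i)
      factor = ℕSolver.solve-∀

    p∤8 : p ∤ 8
    -- Since p divides p² = 8s + 1, dividing 8 would make it divide 1.
    p∤8 p∣8 = ¬prime[1] (subst Prime (∣1⇒≡1 (∣m+n∣m⇒∣n (subst (p ∣_) p*p≡ (m∣m*n p)) (∣m⇒∣m*n s p∣8))) pr)

    p∤i : p ∤ i
    p∤i p∣i = ℕ.<⇒≱ i<p (∣⇒≤ {{ℕ.>-nonZero 1≤i}} p∣i)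

    p∤w : p ∤ w
    p∤w p∣w = [ p∤8 , p∤i ]′ (euclidsLemma 8 i pr (∣m+n∣m⇒∣n p∣w (m∣m*n (8 * n + 5))))

  -- The index belongs to the progression of level α, at the point p² n + p i + 5s, where the
  -- coefficient of ψ(q) ψ(q⁴) is zero.
  b₁₆-even : ∀ α n i → 1 ≤ i → i ≤ p ∸ 1 →
    b 16 (p ^ (2 * α + 2) * n + ((8 * i + 5 * p) * p ^ (2 * α + 1) ∸ 5) / 8) ≡ 0 [mod 2 ]
  b₁₆-even α n i 1≤i i≤p∸1 = parity≡⇒≡[mod2]
    (b 16 (p ^ (2 * α + 2) * n + ((8 * i + 5 * p) * p ^ (2 * α + 1) ∸ 5) / 8)) 0 (begin
    parity (b 16 (p ^ (2 * α + 2) * n + ((8 * i + 5 * p) * p ^ (2 * α + 1) ∸ 5) / 8))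
      ≡⟨ cong (parity ∘ b 16) index ⟩
    parity (b 16 (Q * (p * p * n + p * i + 5 * s) + 5 * e α))
      ≡⟨ b₁₆-progression α (p * p * n + p * i + 5 * s) ⟩
    parity ((ψ ⊛ ψ ⟨q^ 4 ⟩) (p * p * n + p * i + 5 * s))
      ≡⟨ cong parity (ψψ₄-vanishes-progression n i 1≤i i<p) ⟩
    0ℙ ∎)
    where
    open ≡-Reasoning
    Q = p ^ (2 * α)

    i<p : i < p
    i<p = subst (i <_) (ℕ.+-comm 1 (h + h)) (s≤s (subst (i ≤_) (ℕ.m+n∸n≡m (h + h) 1) i≤p∸1))

    numerator : (8 * i + 5 * p) * p ^ (2 * α + 1) ≡ (Q * p * i + 5 * (s * Q + e α)) * 8 + 5
    numerator = begin
      (8 * i + 5 * p) * p ^ (2 * α + 1)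
        ≡⟨ cong ((8 * i + 5 * p) *_) (ℕ.^-distribˡ-+-* p (2 * α) 1) ⟩
      (8 * i + 5 * p) * (Q * (p * 1))
        ≡⟨ expand i p Q ⟩
      Q * p * i * 8 + 5 * (p * p * Q)
        ≡⟨ cong (λ a → Q * p * i * 8 + 5 * a)
             (trans (cong (_* Q) p*p≡) (trans (split s Q) (cong (8 * (s * Q) +_) (p^2α≡ α)))) ⟩
      Q * p * i * 8 + 5 * (8 * (s * Q) + (8 * e α + 1))
        ≡⟨ gather (Q * p * i) (s * Q) (e α) ⟩
      (Q * p * i + 5 * (s * Q + e α)) * 8 + 5 ∎
      where
      expand : ∀ i p Q → (8 * i + 5 * p) * (Q * (p * 1)) ≡ Q * p * i * 8 + 5 * (p * p * Q)
      expand = ℕSolver.solve-∀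
      split : ∀ s Q → (8 * s + 1) * Q ≡ 8 * (s * Q) + Q
      split = ℕSolver.solve-∀
      gather : ∀ a c u → a * 8 + 5 * (8 * c + (8 * u + 1)) ≡ (a + 5 * (c + u)) * 8 + 5
      gather = ℕSolver.solve-∀

    index : p ^ (2 * α + 2) * n + ((8 * i + 5 * p) * p ^ (2 * α + 1) ∸ 5) / 8
      ≡ Q * (p * p * n + p * i + 5 * s) + 5 * e α
    index = begin
      p ^ (2 * α + 2) * n + ((8 * i + 5 * p) * p ^ (2 * α + 1) ∸ 5) / 8
        ≡⟨ cong₂ (λ a c → a * n + (c ∸ 5) / 8) (ℕ.^-distribˡ-+-* p (2 * α) 2) numerator ⟩
      Q * (p * (p * 1)) * n + ((Q * p * i + 5 * (s * Q + e α)) * 8 + 5 ∸ 5) / 8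
        ≡⟨ cong (λ a → Q * (p * (p * 1)) * n + a / 8)
             (ℕ.m+n∸n≡m ((Q * p * i + 5 * (s * Q + e α)) * 8) 5) ⟩
      Q * (p * (p * 1)) * n + (Q * p * i + 5 * (s * Q + e α)) * 8 / 8
        ≡⟨ cong (Q * (p * (p * 1)) * n +_) (ℕ.m*n/n≡m (Q * p * i + 5 * (s * Q + e α)) 8) ⟩
      Q * (p * (p * 1)) * n + (Q * p * i + 5 * (s * Q + e α))
        ≡⟨ regroup Q p n i s (e α) ⟩
      Q * (p * p * n + p * i + 5 * s) + 5 * e α ∎
      where
      regroup : ∀ Q p n i s u → Q * (p * (p * 1)) * n + (Q * p * i + 5 * (s * Q + u))
        ≡ Q * (p * p * n + p * i + 5 * s) + 5 * u
      regroup = ℕSolver.solve-∀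

4∣p+1⇒odd : ∀ {p} → 4 ∣ p + 1 → ∃[ h ] p ≡ h + h + 1
4∣p+1⇒odd {p} (divides zero    eq) = ⊥-elim (ℕ.1+n≢0 (trans (ℕ.+-comm 1 p) eq))
4∣p+1⇒odd {p} (divides (suc k) eq) = suc (k + k) , ℕ.+-cancelʳ-≡ 1 p _ (trans eq (expand k))
  where
  expand : ∀ k → suc k * 4 ≡ suc (k + k) + suc (k + k) + 1 + 1
  expand = ℕSolver.solve-∀

theorem3p24 : ∀ (p : ℕ) → Prime p → 4 ∣ (p + 1) → ∀ (α : ℕ) →
    ((λ n → b 16 (p ^ (2 * α) * n + (5 * p ^ (2 * α) ∸ 5) / 8)) ≋ ψ ⊛ (ψ ⟨q^ 4 ⟩) [mod 2 ])
    × (∀ (n i : ℕ) → 1 ≤ i → i ≤ p ∸ 1 →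
         b 16 (p ^ (2 * α + 2) * n + ((8 * i + 5 * p) * p ^ (2 * α + 1) ∸ 5) / 8) ≡ 0 [mod 2 ])
theorem3p24 p pr 4∣p+1 α with h , refl ← 4∣p+1⇒odd 4∣p+1 = b₁₆-series h pr 4∣p+1 α , b₁₆-even h pr 4∣p+1 α
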